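{- Let $r\ge 3$. For all sufficiently large $n$, \[ \mathrm{ex}^{\mathrm{conn}}_r(n,\mathcal{B}P_{r+1})=n-r+1. \]
   Context: An $r$-uniform hypergraph has hyperedges that are $r$-element subsets of the vertex set. A Berge path of length $k$, denoted $\mathcal{B}P_k$, consists of $k+1$ distinct vertices $v_1,\dots,v_{k+1}$ and $k$ distinct hyperedges $e_1,\dots,e_k$ with $\{v_i,v_{i+1}\}\subseteq e_i$ for all $i$. A hypergraph is connected if for any two of its vertices there is a Berge path containing both. $\mathrm{ex}^{\mathrm{conn}}_r(n,\mathcal{B}P_k)$ is the maximum number of hyperedges in an $n$-vertex connected $r$-uniform hypergraph containing no Berge path of length $k$. -}

module Defs where

open import Data.Nat using (ℕ; suc; _≤_; _∸_; _+_)
open import Data.Fin using (Fin; inject₁) renaming (suc to fsuc)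
open import Data.Fin.Subset using (Subset; _∈_; ∣_∣)
open import Data.Product using (Σ; ∃; _×_)
open import Relation.Binary.PropositionalEquality using (_≡_)
open import Relation.Nullary using (¬_)
open import Function.Definitions using (Injective)

record Hypergraph (r n : ℕ) : Set where
  field
    m       : ℕ
    edge    : Fin m → Subset n
    edge-inj : Injective _≡_ _≡_ edge
    uniform : ∀ i → ∣ edge i ∣ ≡ r
open Hypergraph public

size : ∀ {r n} → Hypergraph r n → ℕ
size H = m H

record BergePath {r n : ℕ} (H : Hypergraph r n) (k : ℕ) : Set where
  field
    vert     : Fin (suc k) → Fin n
    vert-inj : Injective _≡_ _≡_ vert
    hedge    : Fin k → Fin (m H)
    hedge-inj : Injective _≡_ _≡_ hedge
    incident : ∀ i → (vert (inject₁ i) ∈ edge H (hedge i))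
                   × (vert (fsuc i) ∈ edge H (hedge i))
open BergePath public

OnPath : ∀ {r n k} {H : Hypergraph r n} → BergePath H k → Fin n → Set
OnPath P x = ∃ λ i → vert P i ≡ x

Connected : ∀ {r n} → Hypergraph r n → Set
Connected {r} {n} H =
  ∀ (x y : Fin n) → Σ ℕ λ k → Σ (BergePath H k) λ P → OnPath P x × OnPath P y

BergePathFree : ∀ {r n} → Hypergraph r n → ℕ → Set
BergePathFree H k = ¬ BergePath H k

IsExConn : (r n k e : ℕ) → Set
IsExConn r n k e =
  (Σ (Hypergraph r n) λ H → Connected H × BergePathFree H k × size H ≡ e)
  × (∀ (H : Hypergraph r n) → Connected H → BergePathFree H k → size H ≤ e)

{-# OPTIONS --safe #-}
{-
The lower bound is attained by r − 1 spine vertices, each further vertex forming a hyperedge with them.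

For the upper bound write u ⇒ v when v lies in the hyperedge matched to u. Directed paths for ⇒ are
Berge paths, since distinct vertices have distinct hyperedges. As n is large, a Berge cycle of length
at least r extends to a path with r + 1 hyperedges, so such cycles do not exist; hence augmenting
paths never get stuck and all hyperedges can be matched to distinct vertices. If there are more than
n − r + 1 hyperedges, at most r vertices stay unmatched.

Let Y be a set of at most r − 2 vertices. A maximal directed path avoiding Y ends in an unmatched
vertex or in a lasso, whose last hyperedge lies in Y ∪ the lasso. Many disjoint lassos with the same
trace on Y would thread together to a path that is too long, so boundedly many vertices meet all
lassos, and every directed path can be continued to one of them. Consequently, if Y can be reached
from sources avoiding any given bounded set, the same holds for Y ∪ {z} for some z: otherwise iterate
the sets blocking each z a bounded number of times, and trace a path from a source back through them.

This yields a set K of r − 1 vertices which can be linked in a row with plenty of choice. Since there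
is no path with r + 2 vertices, all but boundedly many sources x have the hyperedge K ∪ {x}. Then
every vertex outside K has degree one, and every hyperedge contains such a vertex.
-}
module Submission where

open import Defs
open import Data.Nat using (ℕ; suc; _≤_; _∸_; _+_)
open import Data.Product using (Σ)
open import Data.Nat using (zero; _<_; _*_; _^_; s≤s; z≤n; _≤?_)
open import Data.Nat.Properties as ℕₚ using (≤-refl; ≤-trans; ≤-reflexive)
open import Data.Nat.Solver using (module +-*-Solver)
open import Data.Fin using (Fin; zero; suc; inject₁; _↑ˡ_; _↑ʳ_; splitAt)
open import Data.Fin.Properties as Finₚ using (_≟_; any?; injective⇒≤; splitAt⁻¹-↑ˡ; splitAt⁻¹-↑ʳ)
open import Data.Fin.Subset using (Subset; ⊤; ⁅_⁆; ∣_∣; inside; outside) renaming (_∈_ to _∈ₛ_)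
open import Data.Fin.Subset.Properties using (⊆-antisym; x∈⁅x⁆; x∈⁅y⁆⇒x≡y; ∣⁅x⁆∣≡1)
open import Data.Vec as Vec using ([]; _∷_)
open import Data.List using (List; []; _∷_; _++_; [_]; length; map; mapMaybe; concatMap; allFin; filter)
open import Data.List.Properties using (length-map; length-++; ++-assoc; length-tabulate)
open import Data.List.Membership.Propositional using (_∈_; _∉_; find; lose)
open import Data.List.Membership.Propositional.Properties
  using (∈-++⁺ˡ; ∈-++⁺ʳ; ∈-++⁻; ∈-map⁺; ∈-map⁻; ∈-allFin; ∈-∃++; ∈-concatMap⁺; ∈-concatMap⁻; ∈-filter⁺; ∈-filter⁻)
open import Data.List.Membership.DecPropositional using () renaming (_∈?_ to mem?)
open import Data.List.Relation.Unary.Any as Any using (Any; here; there)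
open import Data.List.Relation.Unary.All as All using ([]; _∷_)
open import Data.List.Relation.Unary.AllPairs using ([]; _∷_)
open import Data.List.Relation.Unary.Unique.Propositional using (Unique)
open import Data.List.Relation.Unary.Unique.Propositional.Properties as Uniqueₚ using (Unique[x∷xs]⇒x∉xs)
open import Data.List.Relation.Binary.Subset.Propositional using (_⊆_)
open import Data.List.Relation.Binary.Disjoint.Propositional using (Disjoint)
open import Data.Maybe using (Maybe; just; nothing)
open import Data.Maybe.Properties as Maybeₚ using (just-injective)
open import Data.Product using (_×_; _,_; proj₁; proj₂; ∃; ∃₂)
open import Data.Sum using (_⊎_; inj₁; inj₂; [_,_]′)
open import Data.Empty using (⊥; ⊥-elim)
open import Function using (_∘_; id)
open import Relation.Nullary using (¬_; Dec; yes; no; contradiction)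
open import Relation.Nullary.Decidable using (¬?; _⊎-dec_; _×-dec_)
open import Relation.Unary using (Decidable)
open import Relation.Binary.PropositionalEquality using (_≡_; _≢_; refl; sym; trans; cong; subst)
open +-*-Solver

-- Lists without repetition and finite combinatorics.

private variable
  A : Set
  k l n : ℕ

_∈?_ : (x : Fin n) (xs : List (Fin n)) → Dec (x ∈ xs)
_∈?_ = mem? _≟_

∉-∷ : ∀ {x y : A} {xs} → x ≢ y → x ∉ xs → x ∉ y ∷ xs
∉-∷ x≢y x∉ (here eq)  = x≢y eq
∉-∷ x≢y x∉ (there x∈) = x∉ x∈

∉-++ : ∀ {x : A} xs {ys} → x ∉ xs → x ∉ ys → x ∉ xs ++ ys
∉-++ xs x∉xs x∉ys = [ x∉xs , x∉ys ]′ ∘ ∈-++⁻ xs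

unique-∷ : ∀ {x : A} {xs} → x ∉ xs → Unique xs → Unique (x ∷ xs)
unique-∷ x∉ u = All.tabulate (λ { y∈ refl → x∉ y∈ }) ∷ u

unique-++⁻ʳ : ∀ (xs : List A) {ys} → Unique (xs ++ ys) → Unique ys
unique-++⁻ʳ []       u       = u
unique-++⁻ʳ (_ ∷ xs) (_ ∷ u) = unique-++⁻ʳ xs u

unique-++⁻ˡ : ∀ (xs : List A) {ys} → Unique (xs ++ ys) → Unique xs
unique-++⁻ˡ []       _        = []
unique-++⁻ˡ (_ ∷ xs) (x≢ ∷ u) = All.tabulate (λ z∈ → All.lookup x≢ (∈-++⁺ˡ z∈)) ∷ unique-++⁻ˡ xs u

unique-++⁻-disjoint : ∀ (xs : List A) {ys} → Unique (xs ++ ys) → Disjoint xs ys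
unique-++⁻-disjoint (x ∷ xs) u (here refl , y∈) = Unique[x∷xs]⇒x∉xs u (∈-++⁺ʳ xs y∈)
unique-++⁻-disjoint (x ∷ xs) (_ ∷ u) (there x∈ , y∈) = unique-++⁻-disjoint xs u (x∈ , y∈)

unique-drop-mid : ∀ (xs : List A) {y ys} → Unique (xs ++ y ∷ ys) → Unique (xs ++ ys)
unique-drop-mid []       (_ ∷ u) = u
unique-drop-mid (x ∷ xs) (x≢ ∷ u) =
  All.tabulate (λ z∈ → All.lookup x≢ (mid xs z∈)) ∷ unique-drop-mid xs u
  where
  mid : ∀ {z : A} xs {y ys} → z ∈ xs ++ ys → z ∈ xs ++ y ∷ ys
  mid xs z∈ = [ ∈-++⁺ˡ , ∈-++⁺ʳ xs ∘ there ]′ (∈-++⁻ xs z∈)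

unique-mid∉ : ∀ (xs : List A) {y ys} → Unique (xs ++ y ∷ ys) → y ∉ xs ++ ys
unique-mid∉ xs u = ∉-++ xs (λ y∈ → unique-++⁻-disjoint xs u (y∈ , here refl))
                           (Unique[x∷xs]⇒x∉xs (unique-++⁻ʳ xs u))

length-mono : ∀ {xs ys : List A} → Unique xs → xs ⊆ ys → length xs ≤ length ys
length-mono {xs = []}     _  _   = z≤n
length-mono {xs = x ∷ xs} u@(_ ∷ uxs) sub with as , bs , refl ← ∈-∃++ (sub (here refl)) =
  ≤-trans (s≤s (length-mono uxs sub′)) (≤-reflexive lem)
  where
  sub′ : xs ⊆ as ++ bs
  sub′ z∈ with ∈-++⁻ as (sub (there z∈))
  ... | inj₁ z∈as         = ∈-++⁺ˡ z∈as
  ... | inj₂ (there z∈bs) = ∈-++⁺ʳ as z∈bs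
  ... | inj₂ (here refl)  = contradiction z∈ (Unique[x∷xs]⇒x∉xs u)
  lem : suc (length (as ++ bs)) ≡ length (as ++ x ∷ bs)
  lem = trans (cong suc (length-++ as)) (sym (trans (length-++ as) (ℕₚ.+-suc (length as) (length bs))))

fresh : (xs : List (Fin n)) → length xs < n → ∃ λ v → v ∉ xs
fresh {n} xs len<n with any? (λ v → ¬? (v ∈? xs))
... | yes p = p
... | no ¬p = contradiction len<n (ℕₚ.≤⇒≯ (≤-trans (≤-reflexive (sym (length-tabulate {n = n} id)))
                (length-mono (Uniqueₚ.allFin⁺ n) λ {v} _ → all v)))
  where
  all : ∀ v → v ∈ xs
  all v with v ∈? xs
  ... | yes v∈ = v∈
  ... | no v∉ = contradiction (v , v∉) ¬p

unique-length≤ : {xs : List (Fin n)} → Unique xs → length xs ≤ n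
unique-length≤ {n} u = ≤-trans (length-mono {ys = allFin n} u (λ {v} _ → ∈-allFin v)) (≤-reflexive (length-tabulate id))

members : Subset n → List (Fin n)
members []            = []
members (inside  ∷ s) = zero ∷ map suc (members s)
members (outside ∷ s) = map suc (members s)

length-members : (s : Subset n) → length (members s) ≡ ∣ s ∣
length-members []            = refl
length-members (inside  ∷ s) = cong suc (trans (length-map suc (members s)) (length-members s))
length-members (outside ∷ s) = trans (length-map suc (members s)) (length-members s)

∈-members⁺ : ∀ {s : Subset n} {x} → x ∈ₛ s → x ∈ members s
∈-members⁺ {s = inside  ∷ s} Vec.here       = here refl
∈-members⁺ {s = inside  ∷ s} (Vec.there x∈) = there (∈-map⁺ suc (∈-members⁺ x∈))
∈-members⁺ {s = outside ∷ s} (Vec.there x∈) = ∈-map⁺ suc (∈-members⁺ x∈)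

∈-members⁻ : ∀ {s : Subset n} {x} → x ∈ members s → x ∈ₛ s
∈-members⁻ {s = inside  ∷ s} (here refl) = Vec.here
∈-members⁻ {s = inside  ∷ s} (there x∈) with _ , y∈ , refl ← ∈-map⁻ suc x∈ = Vec.there (∈-members⁻ y∈)
∈-members⁻ {s = outside ∷ s} x∈ with _ , y∈ , refl ← ∈-map⁻ suc x∈ = Vec.there (∈-members⁻ y∈)

members-unique : (s : Subset n) → Unique (members s)
members-unique []            = []
members-unique (inside  ∷ s) = unique-∷ (λ z∈ → case₀ (∈-map⁻ suc z∈)) (Uniqueₚ.map⁺ Finₚ.suc-injective (members-unique s))
  where
  case₀ : ¬ (∃ λ y → y ∈ members s × zero ≡ Fin.suc y)
  case₀ (_ , _ , ())
members-unique (outside ∷ s) = Uniqueₚ.map⁺ Finₚ.suc-injective (members-unique s)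

-- Over a finite domain, double negation passes constructively through a universal quantifier. This
-- later picks blocking sets for all vertices at once.
¬¬-finite-choice : ∀ {n} {P : Fin n → Set} → (∀ i → ¬ ¬ P i) → ¬ ¬ (∀ i → P i)
¬¬-finite-choice {zero}  _ ¬all = ¬all λ ()
¬¬-finite-choice {suc n} ¬¬P ¬all =
  ¬¬P zero λ p₀ → ¬¬-finite-choice (¬¬P ∘ suc) λ ps → ¬all λ { zero → p₀ ; (suc i) → ps i }

-- A discrete intermediate value principle. Both directions of change occur because `i` and `j` come
-- in no fixed order.
step-across : ∀ {k} {P : Fin (suc k) → Set} → Decidable P → ∀ {i j} → P i → ¬ P j →
              ∃ λ t → (P (inject₁ t) × ¬ P (suc t)) ⊎ (¬ P (inject₁ t) × P (suc t))
step-across {zero}  P? {zero} {zero} p ¬p = contradiction p ¬p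
step-across {suc k} {P} P? {i} {j} p ¬p with P? zero | P? (suc zero)
... | yes p₀ | no ¬p₁ = zero , inj₁ (p₀ , ¬p₁)
... | no ¬p₀ | yes p₁ = zero , inj₂ (¬p₀ , p₁)
step-across {suc k} {P} P? {zero}  {zero}  p ¬p | yes _ | yes _ = contradiction p ¬p
step-across {suc k} {P} P? {zero}  {suc j} p ¬p | yes _ | yes p₁
  with t , q ← step-across (P? ∘ suc) {zero} {j} p₁ ¬p = suc t , q
step-across {suc k} {P} P? {suc i} {zero}  p ¬p | yes p₀ | yes _ = contradiction p₀ ¬p
step-across {suc k} {P} P? {suc i} {suc j} p ¬p | _ | _
  with t , q ← step-across (P? ∘ suc) {i} {j} p ¬p = suc t , q
step-across {suc k} {P} P? {zero}  {j}     p ¬p | no ¬p₀ | no _ = contradiction p ¬p₀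
step-across {suc k} {P} P? {suc i} {zero}  p ¬p | no _ | no ¬p₁
  with t , q ← step-across (P? ∘ suc) {i} {zero} p ¬p₁ = suc t , q

nonempty : (xs : List A) → 1 ≤ length xs → ∃ λ x → x ∈ xs
nonempty (x ∷ _) _ = x , here refl

length-concatMap≤ : ∀ {A B : Set} {b} (f : A → List B) → (∀ x → length (f x) ≤ b) → ∀ xs → length (concatMap f xs) ≤ length xs * b
length-concatMap≤ f f≤ []       = z≤n
length-concatMap≤ f f≤ (x ∷ xs) = ≤-trans (≤-reflexive (length-++ (f x)))
  (ℕₚ.+-mono-≤ (f≤ x) (length-concatMap≤ f f≤ xs))

-- traceBound bounds the vertices used while threading a trace, hitBound a set meeting all lassos,
-- pendantBound the vertices used while linking the whole core.
traceBound hitBound pendantBound : ℕ → ℕ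
traceBound r   = suc r + 2 * r
hitBound r     = r + 2 ^ r * traceBound r
pendantBound r = r + r * suc (r + r)

-- Berge paths as an inductive family.

module BergePaths {r n : ℕ} (H : Hypergraph r n) where

  V E : Set
  V = Fin n
  E = Fin (m H)

  infix 4 _∈ₑ_
  _∈ₑ_ : V → E → Set
  v ∈ₑ f = v ∈ members (edge H f)

  length-edge : ∀ f → length (members (edge H f)) ≡ r
  length-edge f = trans (length-members (edge H f)) (uniform H f)

  edge≤ : ∀ f {xs} → (∀ {v} → v ∈ₑ f → v ∈ xs) → r ≤ length xs
  edge≤ f sub = ≤-trans (≤-reflexive (sym (length-edge f))) (length-mono (members-unique (edge H f)) sub)

  -- VS and ES may be any supersets of the vertices before v and of the hyperedges
  -- already used; k is the exact length.
  data Path : V → List V → List E → ℕ → Set where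
    start : ∀ {v VS ES} → Path v VS ES 0
    step  : ∀ {v w VS ES k} f → Path v VS ES k → v ∈ₑ f → w ∈ₑ f → w ∉ v ∷ VS → f ∉ ES →
            Path w (v ∷ VS) (f ∷ ES) (suc k)
    weaken : ∀ {v VS ES VS′ ES′ k} → VS ⊆ VS′ → ES ⊆ ES′ → Path v VS ES k → Path v VS′ ES′ k

  -- Freeness excludes one exact length, so a longer path has to be cut back before it can
  -- contradict it.
  truncate : ∀ {v VS ES} → k ≤ l → Path v VS ES l → ∃ λ v′ → ∃₂ λ VS′ ES′ → Path v′ VS′ ES′ k
  truncate k≤l P with ℕₚ.m≤n⇒m<n∨m≡n k≤l
  ... | inj₂ refl = _ , _ , _ , P
  truncate k≤l (step f P _ _ _ _) | inj₁ (s≤s k<l) = truncate k<l P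
  truncate k≤l (weaken _ _ P) | inj₁ k<l = truncate k≤l P

  toBergePath : ∀ {v VS ES} → Path v VS ES k →
                Σ (BergePath H k) λ P → vert P zero ≡ v × (∀ i → vert P (suc i) ∈ VS) × (∀ i → hedge P i ∈ ES)
  toBergePath {v = v} start = record
    { vert = λ _ → v ; vert-inj = λ { {zero} {zero} _ → refl } ; hedge = λ () ; hedge-inj = λ { {()} } ; incident = λ () }
    , refl , (λ ()) , λ ()
  toBergePath (weaken VS⊆ ES⊆ P) with Q , eq , inVS , inES ← toBergePath P =
    Q , eq , (λ i → VS⊆ (inVS i)) , (λ i → ES⊆ (inES i))
  toBergePath (step {v = v} {w} {VS} {ES} {k} f P v∈ w∈ w∉ f∉) with Q , eq , inVS , inES ← toBergePath P =
    record { vert = vert′ ; vert-inj = vert-inj′ ; hedge = hedge′ ; hedge-inj = hedge-inj′ ; incident = incident′ }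
    , refl , used , λ { zero → here refl ; (suc i) → there (inES i) }
    where
    vert′ : Fin (suc (suc k)) → V
    vert′ zero    = w
    vert′ (suc i) = vert Q i
    used : ∀ i → vert Q i ∈ v ∷ VS
    used zero    = here eq
    used (suc i) = there (inVS i)
    vert-inj′ : ∀ {i j} → vert′ i ≡ vert′ j → i ≡ j
    vert-inj′ {zero}  {zero}  _ = refl
    vert-inj′ {zero}  {suc j} refl = contradiction (used j) w∉
    vert-inj′ {suc i} {zero}  refl = contradiction (used i) w∉
    vert-inj′ {suc i} {suc j} e = cong suc (vert-inj Q e)
    hedge′ : Fin (suc k) → E
    hedge′ zero    = f
    hedge′ (suc i) = hedge Q i
    hedge-inj′ : ∀ {i j} → hedge′ i ≡ hedge′ j → i ≡ j
    hedge-inj′ {zero}  {zero}  _ = refl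
    hedge-inj′ {zero}  {suc j} refl = contradiction (inES j) f∉
    hedge-inj′ {suc i} {zero}  refl = contradiction (inES i) f∉
    hedge-inj′ {suc i} {suc j} e = cong suc (hedge-inj Q e)
    incident′ : ∀ i → (vert′ (inject₁ i) ∈ₛ edge H (hedge′ i)) × (vert′ (suc i) ∈ₛ edge H (hedge′ i))
    incident′ zero    = ∈-members⁻ w∈ , subst (_∈ₛ edge H f) (sym eq) (∈-members⁻ v∈)
    incident′ (suc i) = incident Q i

  -- Connectivity enters the upper bound only through this cut form: a Berge path containing `x` and
  -- `y` has two consecutive vertices on opposite sides of `P`.
  crossing : Connected H → {P : V → Set} → Decidable P → ∀ {x y} → P x → ¬ P y →
             ∃ λ f → ∃₂ λ a b → a ∈ₑ f × b ∈ₑ f × P a × ¬ P b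
  crossing conn {P} P? {x} {y} px ¬py with k , Q , (i , refl) , (j , refl) ← conn x y
    with step-across {k} {P ∘ vert Q} (P? ∘ vert Q) {i} {j} px ¬py
  ... | t , inj₁ (p , ¬p) = hedge Q t , _ , _ , ∈-members⁺ (proj₁ (incident Q t)) , ∈-members⁺ (proj₂ (incident Q t)) , p , ¬p
  ... | t , inj₂ (¬p , p) = hedge Q t , _ , _ , ∈-members⁺ (proj₂ (incident Q t)) , ∈-members⁺ (proj₁ (incident Q t)) , p , ¬p

-- Directed paths and cycles of a matching.

module Matching {r n : ℕ} (H : Hypergraph r n) (free : BergePathFree H (suc r))
  (σ : Fin n → Maybe (Fin (m H)))
  (σ-valid : ∀ {x f} → σ x ≡ just f → x ∈ members (edge H f))
  (σ-inj : ∀ {x y f} → σ x ≡ just f → σ y ≡ just f → x ≡ y) where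

  open BergePaths H

  noPath : ∀ {v VS ES k} → Path v VS ES k → k ≤ r
  noPath {k = k} P with k ≤? r
  ... | yes k≤r = k≤r
  ... | no k≰r with _ , _ , _ , Q ← truncate (ℕₚ.≰⇒> k≰r) P = contradiction (proj₁ (toBergePath Q)) free

  labels : List V → List E
  labels = mapMaybe σ

  ∈-labels⁻ : ∀ {f} xs → f ∈ labels xs → ∃ λ x → x ∈ xs × σ x ≡ just f
  ∈-labels⁻ (x ∷ xs) f∈ with σ x in eq
  ∈-labels⁻ (x ∷ xs) (here refl) | just f = x , here refl , eq
  ∈-labels⁻ (x ∷ xs) (there f∈)  | just f with y , y∈ , e ← ∈-labels⁻ xs f∈ = y , there y∈ , e
  ∈-labels⁻ (x ∷ xs) f∈ | nothing with y , y∈ , e ← ∈-labels⁻ xs f∈ = y , there y∈ , e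

  ∈-labels⁺ : ∀ {f x} xs → x ∈ xs → σ x ≡ just f → f ∈ labels xs
  ∈-labels⁺ (x ∷ xs) (here refl) eq with just _ ← σ x with refl ← eq = here refl
  ∈-labels⁺ (x ∷ xs) (there x∈) eq with σ x
  ... | just _  = there (∈-labels⁺ xs x∈ eq)
  ... | nothing = ∈-labels⁺ xs x∈ eq

  labels-mono : ∀ {xs ys} → xs ⊆ ys → labels xs ⊆ labels ys
  labels-mono {xs} {ys} sub f∈ with x , x∈ , eq ← ∈-labels⁻ xs f∈ = ∈-labels⁺ ys (sub x∈) eq

  label∉ : ∀ {x f xs} → σ x ≡ just f → x ∉ xs → f ∉ labels xs
  label∉ {xs = xs} eq x∉ f∈ with y , y∈ , eq′ ← ∈-labels⁻ xs f∈ with refl ← σ-inj eq eq′ = x∉ y∈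

  infix 4 _⇒_
  _⇒_ : V → V → Set
  x ⇒ y = ∃ λ f → σ x ≡ just f × y ∈ₑ f

  -- The list holds the vertices before the endpoint, latest first.
  data DPath (x : V) : V → List V → Set where
    nil  : DPath x x []
    snoc : ∀ {u v l} → DPath x u l → u ⇒ v → DPath x v (u ∷ l)

  source∈ : ∀ {x v l} → DPath x v l → x ∈ v ∷ l
  source∈ nil        = here refl
  source∈ (snoc p _) = there (source∈ p)

  cons : ∀ {x y v l} → x ⇒ y → DPath y v l → DPath x v (l ++ [ x ])
  cons x⇒y nil          = snoc nil x⇒y
  cons x⇒y (snoc p u⇒v) = snoc (cons x⇒y p) u⇒v

  prefix : ∀ {x v z l} → DPath x v l → z ∈ v ∷ l → ∃₂ λ p l′ → DPath x z l′ × v ∷ l ≡ p ++ z ∷ l′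
  prefix p (here refl) = [] , _ , p , refl
  prefix (snoc {v = v} p _) (there z∈) with q , l′ , p′ , eq ← prefix p z∈ = v ∷ q , l′ , p′ , cong (v ∷_) eq

  suffix : ∀ {x v u l} → DPath x v l → u ∈ l → ∃₂ λ w l₁ → ∃ λ l₂ → u ⇒ w × DPath w v l₁ × l ≡ l₁ ++ u ∷ l₂
  suffix (snoc p u⇒v) (here refl) = _ , [] , _ , u⇒v , nil , refl
  suffix (snoc {u = u} p e) (there u∈) with w , l₁ , l₂ , u⇒w , q , refl ← suffix p u∈ =
    w , u ∷ l₁ , l₂ , u⇒w , snoc q e , refl

  -- Each `u` in `l` contributes the hyperedge matched to it, which also contains the next vertex.
  -- Injectivity of `σ` keeps these hyperedges distinct, and the one matched to the endpoint `v`
  -- stays unspent.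
  forward : ∀ {x v l VS ES k} → Path x VS ES k → DPath x v l → Unique (v ∷ l) → Disjoint (v ∷ l) VS →
            (∀ {u f} → u ∈ l → σ u ≡ just f → f ∉ ES) →
            Path v (l ++ VS) (labels l ++ ES) (length l + k)
  forward P nil _ _ _ = P
  forward {v = v} {VS = VS} {ES} P (snoc {u = u} {l = l} p (f , eq , v∈)) uq@(_ ∷ uq′) dis new =
    weaken id sub
      (step f (forward P p uq′ (λ (a , b) → dis (there a , b)) (λ u∈ → new (there u∈))) (σ-valid eq) v∈
        (∉-∷ (λ { refl → Unique[x∷xs]⇒x∉xs uq (here refl) })
             (∉-++ l (Unique[x∷xs]⇒x∉xs uq ∘ there) (λ v∈VS → dis (here refl , v∈VS))))
        (∉-++ (labels l) (label∉ eq (Unique[x∷xs]⇒x∉xs uq′)) (new (here refl) eq)))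
    where
    sub : f ∷ labels l ++ ES ⊆ labels (u ∷ l) ++ ES
    sub (here refl) = ∈-++⁺ˡ (∈-labels⁺ (u ∷ l) (here refl) eq)
    sub (there f∈) with ∈-++⁻ (labels l) f∈
    ... | inj₁ f∈l = ∈-++⁺ˡ (labels-mono {l} {u ∷ l} there f∈l)
    ... | inj₂ f∈ES = ∈-++⁺ʳ (labels (u ∷ l)) f∈ES

  dpath-length : ∀ {x v l} → DPath x v l → Unique (v ∷ l) → length l ≤ r
  dpath-length {l = l} p uq = ≤-trans (≤-reflexive (sym (ℕₚ.+-identityʳ (length l))))
    (noPath (forward {VS = []} {ES = []} start p uq (λ ()) (λ _ _ ())))

  -- In a path all of whose hyperedges are matched, one list records the used vertices
  -- together with the partners of the used hyperedges.
  MPath : V → List V → ℕ → Set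
  MPath v X k = Path v X (labels X) k

  widen : ∀ {v X Y k} → X ⊆ Y → MPath v X k → MPath v Y k
  widen X⊆Y P = weaken X⊆Y (labels-mono X⊆Y) P

  -- The partner `u` may lie off the path: recording it in the list marks its hyperedge as used.
  mstep : ∀ {v w u f X k} → MPath v X k → σ u ≡ just f → v ∈ₑ f → w ∈ₑ f → u ∉ X → w ∉ v ∷ X →
          MPath w (v ∷ u ∷ X) (suc k)
  mstep {v} {w} {u} {f} {X} P eq v∈ w∈ u∉ w∉ = weaken (λ { (here e) → here e ; (there e) → there (there e) }) sub
      (step f P v∈ w∈ w∉ (label∉ eq u∉))
    where
    sub : f ∷ labels X ⊆ labels (v ∷ u ∷ X)
    sub (here refl) = ∈-labels⁺ (v ∷ u ∷ X) (there (here refl)) eq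
    sub (there f∈)  = labels-mono {X} {v ∷ u ∷ X} (there ∘ there) f∈

  mforward : ∀ {x v l X k} → MPath x X k → DPath x v l → Unique (v ∷ l) → Disjoint (v ∷ l) X →
             MPath v (l ++ X) (length l + k)
  mforward {l = l} {X} P p uq dis = weaken id sub
    (forward P p uq dis (λ u∈ eq → label∉ eq (λ u∈X → dis (there u∈ , u∈X))))
    where
    sub : labels l ++ labels X ⊆ labels (l ++ X)
    sub f∈ with ∈-++⁻ (labels l) f∈
    ... | inj₁ f∈l = labels-mono {l} {l ++ X} ∈-++⁺ˡ f∈l
    ... | inj₂ f∈X = labels-mono {X} {l ++ X} (∈-++⁺ʳ l) f∈X

  -- The hyperedge matched to `u` contains both ends of an arc `u ⇒ v`, so a Berge path may follow
  -- arcs against their direction.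
  mbackward : ∀ {x v l X k} → MPath v X k → DPath x v l → Unique l → Disjoint l (v ∷ X) →
              MPath x (v ∷ l ++ X) (length l + k)
  mbackward P nil _ _ = widen there P
  mbackward {v = v} {X = X} {k} P (snoc {u = u} {l = l} p (f , eq , v∈)) uq@(_ ∷ uq′) dis =
    subst (MPath _ _) (ℕₚ.+-suc (length l) k)
      (widen sub (mbackward (mstep P eq v∈ (σ-valid eq) (λ u∈ → dis (here refl , there u∈)) (λ u∈ → dis (here refl , u∈)))
        p uq′ dis′))
    where
    dis′ : Disjoint l (u ∷ v ∷ u ∷ X)
    dis′ (a , here refl) = Unique[x∷xs]⇒x∉xs uq a
    dis′ (a , there (here refl)) = dis (there a , here refl)
    dis′ (a , there (there (here refl))) = Unique[x∷xs]⇒x∉xs uq a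
    dis′ (a , there (there (there b))) = dis (there a , there b)
    sub : u ∷ l ++ v ∷ u ∷ X ⊆ v ∷ u ∷ l ++ X
    sub (here e) = there (here e)
    sub (there a) with ∈-++⁻ l a
    ... | inj₁ b = there (there (∈-++⁺ˡ b))
    ... | inj₂ (here e) = here e
    ... | inj₂ (there (here e)) = there (here e)
    ... | inj₂ (there (there b)) = there (there (∈-++⁺ʳ l b))

  record Cycle (x : V) (l : List V) : Set where
    field
      head   : V
      path   : DPath head x l
      close  : x ⇒ head
      unique : Unique (x ∷ l)
  open Cycle

  rotate : ∀ {x u l} → Cycle x (u ∷ l) → Cycle u (l ++ [ x ])
  rotate {x} {u} {l} c with snoc p u⇒x ← path c = record
    { head = x ; path = cons (close c) p ; close = u⇒x
    ; unique = Uniqueₚ.++⁺ (tail (unique c)) ([] ∷ []) λ { (a , here refl) → Unique[x∷xs]⇒x∉xs (unique c) a } }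
    where
    tail : ∀ {y ys} → Unique (y ∷ ys) → Unique ys
    tail (_ ∷ u) = u

  rotateTo : ∀ l₁ {l₂ x v} → Cycle x (l₁ ++ v ∷ l₂) →
             ∃ λ l′ → Cycle v l′ × v ∷ l′ ⊆ x ∷ l₁ ++ v ∷ l₂ × length l′ ≡ length (l₁ ++ v ∷ l₂)
  rotateTo [] {l₂} {x} {v} c = _ , rotate c , sub , trans (length-++ l₂) (ℕₚ.+-comm (length l₂) 1)
    where
    sub : v ∷ l₂ ++ [ x ] ⊆ x ∷ v ∷ l₂
    sub (here e) = there (here e)
    sub (there a) with ∈-++⁻ l₂ a
    ... | inj₁ b = there (there b)
    ... | inj₂ (here e) = here e
  rotateTo (u ∷ l₁) {l₂} {x} {v} c
    with l′ , c′ , sub , len ← rotateTo l₁ (subst (Cycle u) (++-assoc l₁ (v ∷ l₂) [ x ]) (rotate c)) =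
    l′ , c′ , sub′ ∘ sub , trans len (trans (trans (length-++ l₁) (ℕₚ.+-suc (length l₁) _))
      (cong suc (trans (cong (length l₁ +_) (trans (length-++ l₂) (ℕₚ.+-comm (length l₂) 1))) (sym (length-++ l₁)))))
    where
    sub′ : u ∷ l₁ ++ v ∷ l₂ ++ [ x ] ⊆ x ∷ u ∷ l₁ ++ v ∷ l₂
    sub′ (here e) = there (here e)
    sub′ (there a) with ∈-++⁻ l₁ a
    ... | inj₁ b = there (there (∈-++⁺ˡ b))
    ... | inj₂ (here e) = there (there (∈-++⁺ʳ l₁ (here e)))
    ... | inj₂ (there b) with ∈-++⁻ l₂ b
    ... | inj₁ d = there (there (∈-++⁺ʳ l₁ (there d)))
    ... | inj₂ (here e) = here e

  -- An entry of `xs` outside `f` would make r + 1 distinct entries in a list of length at most r.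
  edge-fill : ∀ f {xs} → (∀ {v} → v ∈ₑ f → v ∈ xs) → length xs ≤ r → ∀ {v} → v ∈ xs → v ∈ₑ f
  edge-fill f {xs} sub len {v} v∈ with v ∈? members (edge H f)
  ... | yes v∈f = v∈f
  ... | no v∉f = contradiction (≤-trans (≤-reflexive (sym (cong suc (length-edge f)))) (≤-trans
      (length-mono (unique-∷ v∉f (members-unique (edge H f))) λ { (here refl) → v∈ ; (there w∈) → sub w∈ }) len)) ℕₚ.1+n≰n

  edge-ext : ∀ {f g} → (∀ {v} → v ∈ₑ f → v ∈ₑ g) → (∀ {v} → v ∈ₑ g → v ∈ₑ f) → f ≡ g
  edge-ext fg gf = edge-inj H (⊆-antisym (∈-members⁻ ∘ fg ∘ ∈-members⁺) (∈-members⁻ ∘ gf ∘ ∈-members⁺))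

  outside-edge? : ∀ f xs → (∀ {v} → v ∈ₑ f → v ∈ xs) ⊎ ∃ λ v → v ∈ₑ f × v ∉ xs
  outside-edge? f xs with Any.any? (λ v → ¬? (v ∈? xs)) (members (edge H f))
  ... | yes p = inj₂ (find p)
  ... | no ¬p = inj₁ λ {v} v∈ → case v v∈
    where
    case : ∀ v → v ∈ₑ f → v ∈ xs
    case v v∈ with v ∈? xs
    ... | yes a = a
    ... | no a = contradiction (lose v∈ a) ¬p

  target : V → List V
  target x with σ x
  ... | just f  = members (edge H f)
  ... | nothing = []

  target-just : ∀ {x f} → σ x ≡ just f → target x ≡ members (edge H f)
  target-just {x} eq with just f ← σ x with refl ← eq = refl

  target-length : ∀ x → length (target x) ≤ r
  target-length x with σ x
  ... | just f  = ≤-reflexive (length-edge f)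
  ... | nothing = z≤n

  -- A hyperedge leaving C ∪ ⋃ σ(C) would extend the cycle C to a path with r + 1 hyperedges.
  module Leaving {x : V} {l : List V} (c : Cycle x l) (2≤r : 2 ≤ r) (r≤ : r ≤ suc (length l))
    {g : E} {a z : V} (a∈g : a ∈ₑ g) (z∈g : z ∈ₑ g)
    (z∉C : z ∉ x ∷ l) (target∈ : ∀ {y f} → y ∈ x ∷ l → σ y ≡ just f → z ∈ₑ f → ⊥) where

    C : List V
    C = x ∷ l
    g-new : ∀ {y f} → y ∈ C → σ y ≡ just f → f ≢ g
    g-new y∈ eq refl = target∈ y∈ eq z∈g
    rotated : ∀ {y} → y ∈ C → ∃ λ l′ → Cycle y l′ × y ∷ l′ ⊆ C × length l′ ≡ length l
    rotated (here refl) = l , c , id , refl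
    rotated (there y∈) with l₁ , l₂ , refl ← ∈-∃++ y∈ = rotateTo l₁ c

    too-long : ∀ {v VS ES k} → Path v VS ES k → suc r ≤ k → ⊥
    too-long P r< = ℕₚ.<⇒≱ r< (noPath P)

    -- The path runs from `z` through `g` to `a`, through `f` to the successor of `y`, and around
    -- the cycle to `y`. Stopping at `y` leaves its hyperedge `f` for the second step, and |C| + 1
    -- hyperedges are used.
    off-cycle : ∀ {y f} → y ∈ C → σ y ≡ just f → a ∈ₑ f → a ∉ C → ⊥
    off-cycle {y} {f} y∈ eq a∈f a∉C with l′ , c′ , sub , len ← rotated y∈
                                   with f′ , eq′ , h∈ ← close c′
                                   with refl ← trans (sym eq) eq′ =
      too-long (forward
          (step f (step g (start {VS = []} {[]}) z∈g a∈g (∉-∷ (λ { refl → target∈ y∈ eq a∈f }) λ ()) λ ())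
            a∈f h∈ (∉-∷ (λ { refl → a∉C (sub (source∈ (path c′))) }) (∉-∷ (λ { refl → z∉C (sub (source∈ (path c′))) }) λ ()))
            (∉-∷ (g-new y∈ eq) λ ()))
          (path c′) (unique c′)
          (λ { (v∈ , here refl) → a∉C (sub v∈) ; (v∈ , there (here refl)) → z∉C (sub v∈) })
          (λ { u∈ eq″ (here refl) → Unique[x∷xs]⇒x∉xs (unique c′) (subst (_∈ l′) (σ-inj eq″ eq) u∈)
             ; u∈ eq″ (there (here refl)) → g-new (sub (there u∈)) eq″ refl }))
        (≤-trans (s≤s (≤-trans r≤ (≤-reflexive (cong suc (sym len))))) (≤-reflexive (ℕₚ.+-comm 2 (length l′))))

    -- Let `u` precede `a` on the cycle. A vertex off the cycle in the hyperedge of `a` or of `u`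
    -- gives a path with |C| + 1 hyperedges, so both hyperedges lie in `C`. If |C| ≤ r both equal
    -- `C`, against injectivity of `σ`; otherwise going around to `a` and on to `z` is already too
    -- long.
    on-cycle : a ∈ C → ⊥
    on-cycle a∈ with rotated a∈
    on-cycle a∈ | [] , _ , _ , len = ℕₚ.<⇒≱ (≤-trans 2≤r r≤) (≤-reflexive (cong suc (sym len)))
    on-cycle a∈ | u ∷ l′ , c₁ , sub , len = final
      where
      c₂ : Cycle u (l′ ++ [ a ])
      c₂ = rotate c₁
      head₂ : head c₂ ≡ a
      head₂ with snoc _ _ ← path c₁ = refl
      sub₂ : u ∷ l′ ++ [ a ] ⊆ C
      sub₂ (here e) = sub (there (here e))
      sub₂ (there v∈) with ∈-++⁻ l′ v∈
      ... | inj₁ v∈l′ = sub (there (there v∈l′))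
      ... | inj₂ (here refl) = a∈
      len₂ : length (l′ ++ [ a ]) ≡ length l
      len₂ = trans (trans (length-++ l′) (ℕₚ.+-comm (length l′) 1)) len
      f₁ = proj₁ (close c₁)
      f₂ = proj₁ (close c₂)
      σ₁ : σ a ≡ just f₁
      σ₁ = proj₁ (proj₂ (close c₁))
      σ₂ : σ u ≡ just f₂
      σ₂ = proj₁ (proj₂ (close c₂))
      full₁ : ∀ {v} → v ∈ₑ f₁ → v ∈ a ∷ u ∷ l′
      full₁ with outside-edge? f₁ (a ∷ u ∷ l′)
      ... | inj₁ p = p
      ... | inj₂ (w , w∈ , w∉) = ⊥-elim (too-long
        (step g (forward (step f₁ (start {VS = []} {[]}) w∈ (proj₂ (proj₂ (close c₁)))
                   (∉-∷ (λ e → w∉ (subst (_∈ a ∷ u ∷ l′) e (source∈ (path c₁)))) λ ()) λ ())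
                 (path c₁) (unique c₁) (λ { (v∈ , here refl) → w∉ v∈ })
                 (λ { u∈ eq (here refl) → Unique[x∷xs]⇒x∉xs (unique c₁) (subst (_∈ u ∷ l′) (σ-inj eq σ₁) u∈) }))
           a∈g z∈g
           (∉-∷ (λ e → z∉C (subst (_∈ C) (sym e) a∈))
               (∉-++ (u ∷ l′) (z∉C ∘ sub ∘ there) λ { (here refl) → target∈ a∈ σ₁ w∈ }))
           (∉-++ (labels (u ∷ l′)) (λ g∈ → let y , y∈ , eq = ∈-labels⁻ (u ∷ l′) g∈ in g-new (sub (there y∈)) eq refl)
                 λ { (here e) → g-new a∈ σ₁ (sym e) }))
        (s≤s (≤-trans r≤ (≤-reflexive (trans (cong suc (sym len)) (ℕₚ.+-comm 1 (length (u ∷ l′))))))))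
      full₂ : ∀ {v} → v ∈ₑ f₂ → v ∈ u ∷ l′ ++ [ a ]
      full₂ with outside-edge? f₂ (u ∷ l′ ++ [ a ])
      ... | inj₁ p = p
      ... | inj₂ (w , w∈ , w∉) = ⊥-elim (too-long
        (step f₂ (forward (step g (start {VS = []} {[]}) z∈g (subst (_∈ₑ g) (sym head₂) a∈g)
                   (∉-∷ (λ e → z∉C (sub₂ (subst (_∈ u ∷ l′ ++ [ a ]) e (source∈ (path c₂))))) λ ()) λ ())
                 (path c₂) (unique c₂) (λ { (v∈ , here refl) → z∉C (sub₂ v∈) })
                 (λ { u∈ eq (here refl) → g-new (sub₂ (there u∈)) eq refl }))
           (σ-valid σ₂) w∈
           (∉-∷ (λ e → w∉ (here e)) (∉-++ (l′ ++ [ a ]) (w∉ ∘ there)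
               λ { (here refl) → target∈ (sub₂ (here refl)) σ₂ w∈ }))
           (∉-++ (labels (l′ ++ [ a ])) (label∉ σ₂ (Unique[x∷xs]⇒x∉xs (unique c₂)))
                 λ { (here e) → g-new (sub₂ (here refl)) σ₂ e }))
        (s≤s (≤-trans r≤ (≤-reflexive (trans (cong suc (sym len₂)) (ℕₚ.+-comm 1 (length (l′ ++ [ a ]))))))))
      final : ⊥
      final with suc r ≤? length (a ∷ u ∷ l′)
      ... | yes r< = too-long
        (step g (forward (start {VS = []} {[]}) (path c₁) (unique c₁) (λ ()) (λ _ _ ())) a∈g z∈g
          (∉-∷ (λ e → z∉C (subst (_∈ C) (sym e) a∈)) (∉-++ (u ∷ l′) (z∉C ∘ sub ∘ there) λ ()))
          (∉-++ (labels (u ∷ l′)) (λ g∈ → let y , y∈ , eq = ∈-labels⁻ (u ∷ l′) g∈ in g-new (sub (there y∈)) eq refl) λ ()))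
        (≤-trans r< (≤-reflexive (cong suc (ℕₚ.+-comm 0 (length (u ∷ l′))))))
      ... | no r≮ = Unique[x∷xs]⇒x∉xs (unique c₁) (here (σ-inj σ₁ (trans σ₂ (cong just (sym f₁≡f₂)))))
        where
        short : length (a ∷ u ∷ l′) ≤ r
        short = ℕₚ.≤-pred (ℕₚ.≰⇒> r≮)
        short₂ : length (u ∷ l′ ++ [ a ]) ≤ r
        short₂ = ≤-trans (≤-reflexive (cong suc (trans (length-++ l′) (ℕₚ.+-comm (length l′) 1)))) short
        12⊆ : a ∷ u ∷ l′ ⊆ u ∷ l′ ++ [ a ]
        12⊆ (here refl) = ∈-++⁺ʳ (u ∷ l′) (here refl)
        12⊆ (there v∈)  = ∈-++⁺ˡ v∈
        21⊆ : u ∷ l′ ++ [ a ] ⊆ a ∷ u ∷ l′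
        21⊆ v∈ with ∈-++⁻ (u ∷ l′) v∈
        ... | inj₁ w∈ = there w∈
        ... | inj₂ (here e) = here e
        f₁≡f₂ : f₁ ≡ f₂
        f₁≡f₂ = edge-ext (edge-fill f₂ full₂ short₂ ∘ 12⊆ ∘ full₁) (edge-fill f₁ full₁ short ∘ 21⊆ ∘ full₂)

  module _ (conn : Connected H) (2≤r : 2 ≤ r) (n-large : suc r * suc r < n) where

    -- A cycle `C` has at most r + 1 vertices, so `C` with all its matched hyperedges covers at most
    -- (r + 1)² < n vertices. Connectivity gives a hyperedge leaving this set, which `Leaving`
    -- refutes when |C| ≥ r.
    cycle-short : ∀ {x l} → Cycle x l → suc (length l) < r
    cycle-short {x} {l} c with suc (suc (length l)) ≤? r
    ... | yes p = p
    ... | no p = ⊥-elim (contra (crossing conn (_∈? reach) (here refl) (proj₂ (fresh reach reach-length))))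
      where
      C reach : List V
      C = x ∷ l
      reach = C ++ concatMap target C
      reach-length : length reach < n
      reach-length = ≤-trans (s≤s (≤-trans (≤-reflexive (length-++ C))
        (≤-trans (ℕₚ.+-monoʳ-≤ (length C) (length-concatMap≤ target target-length C))
        (≤-trans (≤-reflexive (sym (ℕₚ.*-suc (length C) r)))
          (ℕₚ.*-monoˡ-≤ (suc r) (s≤s (dpath-length (path c) (unique c)))))))) n-large
      target∈ : ∀ {y v f} → y ∈ C → σ y ≡ just f → v ∈ₑ f → v ∈ reach
      target∈ y∈ eq v∈ = ∈-++⁺ʳ C (∈-concatMap⁺ target (lose y∈ (subst (_ ∈_) (sym (target-just eq)) v∈)))
      contra : (∃ λ f → ∃₂ λ a b → a ∈ₑ f × b ∈ₑ f × a ∈ reach × b ∉ reach) → ⊥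
      contra (g , a , z , a∈g , z∈g , a∈ , z∉) = split (a ∈? C) (∈-++⁻ C a∈)
        where
        open Leaving c 2≤r (ℕₚ.≤-pred (ℕₚ.≰⇒> p)) a∈g z∈g (z∉ ∘ ∈-++⁺ˡ) (λ y∈ eq z∈ → z∉ (target∈ y∈ eq z∈))
          using (off-cycle; on-cycle)
        split : Dec (a ∈ C) → a ∈ C ⊎ a ∈ concatMap target C → ⊥
        split (yes a∈C) _          = on-cycle a∈C
        split (no a∉C)  (inj₁ a∈C) = a∉C a∈C
        split (no a∉C)  (inj₂ a∈T) with y , y∈ , a∈t ← find (∈-concatMap⁻ target {xs = C} a∈T) with σ y in eq
        ... | just f = off-cycle y∈ eq a∈t a∉C

-- Lassos and bounded sets meeting them.

module Lassos {r n : ℕ} (H : Hypergraph r n) (free : BergePathFree H (suc r))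
  (σ : Fin n → Maybe (Fin (m H)))
  (σ-valid : ∀ {x f} → σ x ≡ just f → x ∈ members (edge H f))
  (σ-inj : ∀ {x y f} → σ x ≡ just f → σ y ≡ just f → x ≡ y) where

  open BergePaths H
  open Matching H free σ σ-valid σ-inj

  -- Cutting at the vertex `h` with `Q` nearest to the source loses no vertex with `Q`. Applied to
  -- membership in a hyperedge, this yields the loop of a lasso.
  firstIn : ∀ {Q : V → Set} → Decidable Q → ∀ {x v l} → DPath x v l → Any Q (v ∷ l) →
            ∃₂ λ h l′ → ∃ λ l″ → DPath h v l′ × l ≡ l′ ++ l″ × Q h × (∀ {w} → w ∈ v ∷ l → Q w → w ∈ v ∷ l′)
  firstIn Q? {v = v} nil (here q) = v , [] , [] , nil , refl , q , λ w∈ _ → w∈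
  firstIn Q? {v = v} {l} (snoc p u⇒v) anyQ with Any.any? Q? l
  ... | yes any′ with h , l′ , l″ , p′ , refl , q , all ← firstIn Q? p any′ =
    h , _ ∷ l′ , l″ , snoc p′ u⇒v , refl , q , λ { (here e) _ → here e ; (there w∈) qw → there (all w∈ qw) }
  ... | no none with anyQ
  ... | here q   = v , [] , l , nil , refl , q , λ { (here e) _ → here e ; (there w∈) qw → contradiction (lose w∈ qw) none }
  ... | there q∈ = contradiction q∈ none

  -- Only the loop is stored; the approach to it is dropped. For empty `Y` a lasso is a cycle
  -- containing its own closing hyperedge, hence has at least r vertices.
  record Lasso (Y : List V) : Set where
    field
      {end head} : V
      {body}     : List V
      {hoop}     : E
      path       : DPath head end body
      unique     : Unique (end ∷ body)
      avoids     : Disjoint (end ∷ body) Y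
      label      : σ end ≡ just hoop
      head∈      : head ∈ₑ hoop
      closed     : ∀ {v} → v ∈ₑ hoop → v ∈ Y ⊎ v ∈ end ∷ body
    vertices : List V
    vertices = end ∷ body
  open Lasso

  Hits : ∀ {Y} → List V → Lasso Y → Set
  Hits Z L = Any (_∈ Z) (vertices L)

  -- Extend the path greedily, avoiding `Y`. An unmatched end lies in `Z`; if the hyperedge of the
  -- end offers no new vertex, a lasso has closed, and the path is cut at a vertex of that lasso in
  -- `Z`. The fuel suffices because directed paths have at most r arcs.
  reach : ∀ {Y Z} → (∀ (L : Lasso Y) → Hits Z L) → (∀ {x} → σ x ≡ nothing → x ∈ Z) →
          ∀ fuel {x₀ x l} → DPath x₀ x l → Unique (x ∷ l) → Disjoint (x ∷ l) Y → r < fuel + length l →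
          ∃₂ λ z l′ → DPath x₀ z l′ × Unique (z ∷ l′) × Disjoint (z ∷ l′) Y × z ∈ Z
  reach hits free∈ zero p uq dis r< = contradiction (dpath-length p uq) (ℕₚ.<⇒≱ r<)
  reach {Y} {Z} hits free∈ (suc fuel) {x₀} {x} {l} p uq dis r< with σ x in eq
  ... | nothing = x , l , p , uq , dis , free∈ eq
  ... | just f with outside-edge? f (Y ++ x ∷ l)
  ... | inj₂ (w , w∈ , w∉) = reach hits free∈ fuel (snoc p (f , eq , w∈))
    (unique-∷ (w∉ ∘ ∈-++⁺ʳ Y) uq)
    (λ { (here refl , b) → w∉ (∈-++⁺ˡ b) ; (there a , b) → dis (a , b) })
    (≤-trans r< (≤-reflexive (sym (ℕₚ.+-suc fuel (length l)))))
  ... | inj₁ f⊆Y∪l with h , l′ , l″ , p′ , refl , h∈ , all ← firstIn (_∈? members (edge H f)) p (here (σ-valid eq)) =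
    z , proj₁ (proj₂ cut) , proj₁ (proj₂ (proj₂ cut)) , uqz , disz , proj₂ (proj₂ hit)
    where
    widen∈ : ∀ {v} → v ∈ x ∷ l′ → v ∈ x ∷ l′ ++ l″
    widen∈ = ∈-++⁺ˡ
    uq′ : Unique (x ∷ l′)
    uq′ = unique-++⁻ˡ (x ∷ l′) uq
    L : Lasso Y
    L = record { path = p′ ; unique = uq′ ; avoids = λ (a , b) → dis (widen∈ a , b) ; label = eq ; head∈ = h∈
               ; closed = λ v∈ → [ inj₁ , (λ v∈l → inj₂ (all v∈l v∈)) ]′ (∈-++⁻ Y (f⊆Y∪l v∈)) }
    hit : ∃ λ z → z ∈ vertices L × z ∈ Z
    hit = find (hits L)
    z = proj₁ hit
    cut = prefix p (widen∈ (proj₁ (proj₂ hit)))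
    eqz : x ∷ l′ ++ l″ ≡ proj₁ cut ++ z ∷ proj₁ (proj₂ cut)
    eqz = proj₂ (proj₂ (proj₂ cut))
    uqz : Unique (z ∷ proj₁ (proj₂ cut))
    uqz = unique-++⁻ʳ (proj₁ cut) (subst Unique eqz uq)
    disz : Disjoint (z ∷ proj₁ (proj₂ cut)) Y
    disz (a , b) = dis (subst (_ ∈_) (sym eqz) (∈-++⁺ʳ (proj₁ cut) a) , b)

  module _ {Y : List V} where

    -- For `T ⊆ Y` the last two conditions say that the hoop has trace exactly `T` on `Y`, since
    -- lassos avoid `Y`.
    Supply : List V → Set
    Supply T = ∀ X → length X ≤ traceBound r →
      ¬ ¬ (∃ λ (L : Lasso Y) → Disjoint (vertices L) X × (∀ {t} → t ∈ T → t ∈ₑ hoop L) ×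
                                (∀ {v} → v ∈ₑ hoop L → v ∈ T ++ vertices L))

    -- Every supplied hoop contains all of `T`, so a fresh lasso carries the path from each trace
    -- vertex to the next. The last lasso is walked backwards in full; it has at least r - |T|
    -- vertices, which brings the path above r hyperedges.
    thread : ∀ {T} → Supply T → T ⊆ Y → ∀ T′ {τ X k} → Unique (τ ∷ T′) → τ ∷ T′ ⊆ T → Disjoint T′ X →
             MPath τ X k → length X + 2 * length T′ ≤ traceBound r → suc (length T) ≤ k + length T′ → ⊥
    thread {T} supply T⊆Y [] {τ} {X} {k} uq sub dis P size long =
      supply X (≤-trans (ℕₚ.m≤m+n (length X) 0) size) λ (L , avoid , T⊆f , f⊆) →
        let P′ = mstep P (label L) (T⊆f (sub (here refl))) (σ-valid (label L)) (λ x∈ → avoid (here refl , x∈))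
                   (∉-∷ (λ { refl → avoids L (here refl , T⊆Y (sub (here refl))) }) (λ x∈ → avoid (here refl , x∈)))
            uqL = unique L
            tail∉ : Disjoint (body L) (end L ∷ τ ∷ end L ∷ X)
            tail∉ = λ { (a , here refl) → Unique[x∷xs]⇒x∉xs uqL a
                      ; (a , there (here refl)) → avoids L (there a , T⊆Y (sub (here refl)))
                      ; (a , there (there (here refl))) → Unique[x∷xs]⇒x∉xs uqL a
                      ; (a , there (there (there b))) → avoid (there a , b) }
            edges : length (body L) + suc k ≤ r
            edges = noPath (mbackward P′ (path L) (unique-++⁻ʳ (end L ∷ []) uqL) tail∉)
        in ℕₚ.<⇒≱ {r} {length (body L) + suc k}
             (≤-trans (s≤s (edge≤ (hoop L) f⊆))
               (≤-trans (≤-reflexive (cong suc (length-++ T)))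
               (≤-trans (ℕₚ.+-monoˡ-≤ (suc (length (body L))) (≤-trans long (≤-reflexive (ℕₚ.+-identityʳ k))))
                 (≤-reflexive (trans (ℕₚ.+-suc k (length (body L))) (trans (cong suc (ℕₚ.+-comm k (length (body L))))
                   (sym (ℕₚ.+-suc (length (body L)) k)))))))) edges
    thread {T} supply T⊆Y (τ′ ∷ T″) {τ} {X} {k} uq@(_ ∷ uq′) sub dis P size long =
      supply X (≤-trans (ℕₚ.m≤m+n (length X) _) size) λ (L , avoid , T⊆f , f⊆) →
        let P′ = mstep P (label L) (T⊆f (sub (here refl))) (T⊆f (sub (there (here refl)))) (λ x∈ → avoid (here refl , x∈))
                   (∉-∷ (λ { refl → Unique[x∷xs]⇒x∉xs uq (here refl) }) (λ τ′∈ → dis (here refl , τ′∈)))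
        in thread supply T⊆Y T″ uq′ (sub ∘ there)
             (λ { (a , here refl) → Unique[x∷xs]⇒x∉xs uq (there a)
                ; (a , there (here refl)) → avoids L (here refl , T⊆Y (sub (there (there a))))
                ; (a , there (there b)) → dis (there a , b) })
             P′ (≤-trans (≤-reflexive size′) size) (≤-trans long (≤-reflexive (ℕₚ.+-suc k (length T″))))
      where
      size′ : suc (suc (length X)) + 2 * length T″ ≡ length X + 2 * suc (length T″)
      size′ = solve 2 (λ a b → con 2 :+ a :+ con 2 :* b := a :+ con 2 :* (con 1 :+ b)) refl (length X) (length T″)

    -- Two lassos with the same trace T, joined through T, form a path on 2(r − |T|) + |T| ≥ r + 2 vertices.
    ¬supply : (∀ {x l} → Cycle x l → suc (length l) < r) → ∀ T → T ⊆ Y → Unique T → 2 + length T ≤ r → ¬ Supply T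
    ¬supply short [] _ _ _ supply = supply [] z≤n λ (L , _ , _ , f⊆) →
      ℕₚ.<⇒≱ (short (record { path = path L ; close = hoop L , label L , head∈ L ; unique = unique L })) (edge≤ (hoop L) f⊆)
    ¬supply _ T@(τ ∷ T′) T⊆Y uq@(_ ∷ uqT′) len supply = supply [] z≤n λ (L , _ , T⊆f , f⊆) →
      let l = length (body L)
          P : MPath (end L) (body L) l
          P = subst (MPath (end L) (body L)) (ℕₚ.+-identityʳ _)
                (widen (λ {v} v∈ → [ id , (λ ()) ]′ (∈-++⁻ (body L) v∈))
                  (mforward {X = []} start (path L) (unique L) λ ()))
          l≤ = dpath-length (path L) (unique L)
          t≤ : length T′ ≤ r
          t≤ = ≤-trans (ℕₚ.m≤n+m (length T′) 3) len
          -- The hoop has at least two vertices outside `T`, so the lasso has at least one arc.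
          1≤l : 1 ≤ l
          1≤l = ℕₚ.≤-pred (ℕₚ.+-cancelˡ-≤ (length T) 2 (suc l)
                  (≤-trans (≤-reflexive (ℕₚ.+-comm (length T) 2)) (≤-trans len (≤-trans (edge≤ (hoop L) f⊆) (≤-reflexive (length-++ T))))))
          τ∉ : τ ∉ end L ∷ body L
          τ∉ = λ τ∈ → avoids L (τ∈ , T⊆Y (here refl))
      in thread supply T⊆Y T′ uq id (λ { (a , b) → avoids L (b , T⊆Y (there a)) })
           (weaken id (λ { (here refl) → ∈-labels⁺ (end L ∷ body L) (here refl) (label L)
                         ; (there f∈) → labels-mono {body L} {end L ∷ body L} there f∈ })
             (step (hoop L) P (σ-valid (label L)) (T⊆f (here refl)) τ∉ (label∉ (label L) (Unique[x∷xs]⇒x∉xs (unique L)))))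
           -- The first lasso records at most r + 1 vertices and each remaining trace vertex adds
           -- two, which is where `traceBound` comes from.
           (ℕₚ.+-mono-≤ (s≤s l≤) (ℕₚ.*-monoʳ-≤ 2 t≤))
           (s≤s (ℕₚ.+-monoˡ-≤ (length T′) 1≤l))

    -- `T` holds the vertices of `Y` known to lie in the hoop, `R` the undecided ones. Each vertex
    -- of `R` splits the lassos into two classes, whence the power of 2. Once `R` is empty, a set
    -- `X` at which `Supply T` fails meets every lasso of the class.
    transversal : (∀ {x l} → Cycle x l → suc (length l) < r) →
      ∀ T R → T ⊆ Y → R ⊆ Y → Unique T → Unique R → Disjoint T R → 2 + (length T + length R) ≤ r →
      ¬ ¬ (∃ λ Z → length Z ≤ 2 ^ length R * traceBound r ×
             (∀ (L : Lasso Y) → (∀ {t} → t ∈ T → t ∈ₑ hoop L) →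
                (∀ {v} → v ∈ₑ hoop L → v ∈ T ⊎ v ∈ R ⊎ v ∈ vertices L) → Hits Z L))
    transversal short T [] T⊆Y R⊆Y uqT uqR dis len none =
      ¬supply short T T⊆Y uqT (≤-trans (≤-reflexive (cong (2 +_) (sym (ℕₚ.+-identityʳ (length T))))) len) λ X X≤ empty →
        none (X , ≤-trans X≤ (≤-reflexive (sym (ℕₚ.+-identityʳ _))) , λ L T⊆f f⊆ → hits X L T⊆f f⊆ empty)
      where
      hits : ∀ X (L : Lasso Y) → (∀ {t} → t ∈ T → t ∈ₑ hoop L) →
             (∀ {v} → v ∈ₑ hoop L → v ∈ T ⊎ v ∈ [] ⊎ v ∈ vertices L) →
             ¬ (∃ λ (L : Lasso Y) → Disjoint (vertices L) X × (∀ {t} → t ∈ T → t ∈ₑ hoop L) ×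
                                (∀ {v} → v ∈ₑ hoop L → v ∈ T ++ vertices L)) → Hits X L
      hits X L T⊆f f⊆ empty with Any.any? (_∈? X) (vertices L)
      ... | yes h = h
      ... | no ¬h = ⊥-elim (empty (L , (λ (a , b) → ¬h (lose a b)) , T⊆f ,
              λ v∈ → [ ∈-++⁺ˡ , [ (λ ()) , ∈-++⁺ʳ T ]′ ]′ (f⊆ v∈)))
    transversal short T (y ∷ R) T⊆Y R⊆Y uqT uqR@(_ ∷ uqR′) dis len none =
      transversal short (y ∷ T) R (λ { (here refl) → R⊆Y (here refl) ; (there a) → T⊆Y a }) (R⊆Y ∘ there)
        (unique-∷ (λ y∈ → dis (y∈ , here refl)) uqT) uqR′
        (λ { (here refl , b) → Unique[x∷xs]⇒x∉xs uqR b ; (there a , b) → dis (a , there b) })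
        (≤-trans (≤-reflexive (cong (2 +_) (sym (ℕₚ.+-suc (length T) (length R))))) len) λ (Z₁ , len₁ , hit₁) →
      transversal short T R T⊆Y (R⊆Y ∘ there) uqT uqR′ (λ (a , b) → dis (a , there b))
        (≤-trans (s≤s (s≤s (ℕₚ.+-monoʳ-≤ (length T) (ℕₚ.n≤1+n _)))) len) λ (Z₂ , len₂ , hit₂) →
      none (Z₁ ++ Z₂ , union≤ Z₁ Z₂ len₁ len₂ , λ L T⊆f f⊆ → both L Z₁ Z₂ hit₁ hit₂ T⊆f f⊆)
      where
      union≤ : ∀ Z₁ Z₂ → length Z₁ ≤ 2 ^ length R * traceBound r → length Z₂ ≤ 2 ^ length R * traceBound r →
             length (Z₁ ++ Z₂) ≤ 2 ^ length (y ∷ R) * traceBound r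
      union≤ Z₁ Z₂ l₁ l₂ = ≤-trans (≤-reflexive (length-++ Z₁)) (≤-trans (ℕₚ.+-mono-≤ l₁ l₂)
        (≤-reflexive (solve 2 (λ a b → a :* b :+ a :* b := (con 2 :* a) :* b) refl (2 ^ length R) (traceBound r))))
      both : ∀ (L : Lasso Y) Z₁ Z₂ →
             (∀ (L : Lasso Y) → (∀ {t} → t ∈ y ∷ T → t ∈ₑ hoop L) →
                (∀ {v} → v ∈ₑ hoop L → v ∈ y ∷ T ⊎ v ∈ R ⊎ v ∈ vertices L) → Hits Z₁ L) →
             (∀ (L : Lasso Y) → (∀ {t} → t ∈ T → t ∈ₑ hoop L) →
                (∀ {v} → v ∈ₑ hoop L → v ∈ T ⊎ v ∈ R ⊎ v ∈ vertices L) → Hits Z₂ L) →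
             (∀ {t} → t ∈ T → t ∈ₑ hoop L) →
             (∀ {v} → v ∈ₑ hoop L → v ∈ T ⊎ v ∈ y ∷ R ⊎ v ∈ vertices L) → Hits (Z₁ ++ Z₂) L
      both L Z₁ Z₂ hit₁ hit₂ T⊆f f⊆ with y ∈? members (edge H (hoop L))
      ... | yes y∈f = Any.map ∈-++⁺ˡ (hit₁ L (λ { (here refl) → y∈f ; (there t∈) → T⊆f t∈ }) inside₁)
        where
        inside₁ : ∀ {v} → v ∈ₑ hoop L → v ∈ y ∷ T ⊎ v ∈ R ⊎ v ∈ vertices L
        inside₁ v∈ with f⊆ v∈
        ... | inj₁ a = inj₁ (there a)
        ... | inj₂ (inj₁ (here e)) = inj₁ (here e)
        ... | inj₂ (inj₁ (there b)) = inj₂ (inj₁ b)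
        ... | inj₂ (inj₂ c) = inj₂ (inj₂ c)
      ... | no y∉f = Any.map (∈-++⁺ʳ Z₁) (hit₂ L T⊆f inside₂)
        where
        inside₂ : ∀ {v} → v ∈ₑ hoop L → v ∈ T ⊎ v ∈ R ⊎ v ∈ vertices L
        inside₂ v∈ with f⊆ v∈
        ... | inj₁ a = inj₁ a
        ... | inj₂ (inj₁ (here refl)) = contradiction v∈ y∉f
        ... | inj₂ (inj₁ (there b)) = inj₂ (inj₁ b)
        ... | inj₂ (inj₂ c) = inj₂ (inj₂ c)

-- Partial matchings and their elementary changes.

module PartialMatchings {r n : ℕ} (H : Hypergraph r n) where

  open BergePaths H

  record PartialMatching : Set where
    field
      partner : V → Maybe E
      valid   : ∀ {x f} → partner x ≡ just f → x ∈ₑ f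
      inj     : ∀ {x y f} → partner x ≡ just f → partner y ≡ just f → x ≡ y
  open PartialMatching public

  Covers : PartialMatching → E → Set
  Covers M f = ∃ λ x → partner M x ≡ just f

  covers? : ∀ M f → Dec (Covers M f)
  covers? M f = any? λ x → Maybeₚ.≡-dec _≟_ (partner M x) (just f)

  Free : PartialMatching → V → Set
  Free M x = partner M x ≡ nothing

  free? : ∀ M → Decidable (Free M)
  free? M x with partner M x
  ... | just _  = no λ ()
  ... | nothing = yes refl

  empty : PartialMatching
  empty = record { partner = λ _ → nothing ; valid = λ () ; inj = λ () }

  assign : ∀ M {x f} → ¬ Covers M f → Free M x → x ∈ₑ f →
           ∃ λ M′ → Covers M′ f × (∀ {g} → Covers M g → Covers M′ g)
  assign M {x} {f} unc fr x∈ = record { partner = p ; valid = val ; inj = inj′ } , (x , here≡) , keep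
    where
    p : V → Maybe E
    p z with z ≟ x
    ... | yes _ = just f
    ... | no _  = partner M z
    val : ∀ {z g} → p z ≡ just g → z ∈ₑ g
    val {z} eq with z ≟ x
    val refl | yes refl = x∈
    val eq   | no _     = valid M eq
    inj′ : ∀ {y z g} → p y ≡ just g → p z ≡ just g → y ≡ z
    inj′ {y} {z} ey ez with y ≟ x | z ≟ x
    inj′ ey   ez   | yes refl | yes refl = refl
    inj′ refl ez   | yes _    | no _     = contradiction (_ , ez) unc
    inj′ ey   refl | no _     | yes _    = contradiction (_ , ey) unc
    inj′ ey   ez   | no _     | no _     = inj M ey ez
    here≡ : p x ≡ just f
    here≡ with x ≟ x
    ... | yes _ = refl
    ... | no x≢x = contradiction refl x≢x
    keep : ∀ {g} → Covers M g → Covers record { partner = p ; valid = val ; inj = inj′ } g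
    keep (z , eq) = z , kept eq
      where
      kept : ∀ {g} → partner M z ≡ just g → p z ≡ just g
      kept eq with z ≟ x
      ... | no _ = eq
      ... | yes refl with () ← trans (sym fr) eq

  -- The elementary exchange of an augmenting path: `g` moves from `w` to `u`, so that `w` can take
  -- over the hyperedge of the preceding arc.
  shift : ∀ M {w u g} → partner M w ≡ just g → Free M u → u ∈ₑ g →
          ∃ λ M′ → Free M′ w × (∀ {h} → Covers M h → Covers M′ h) × (∀ {h} → Covers M′ h → Covers M h) ×
                   (∀ z → z ≢ w → z ≢ u → partner M′ z ≡ partner M z)
  shift M {w} {u} {g} σw fr u∈ = M′ , free-w , keep , unkeep , same
    where
    p : V → Maybe E
    p z with z ≟ w | z ≟ u
    ... | yes _ | _     = nothing
    ... | no _  | yes _ = just g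
    ... | no _  | no _  = partner M z
    val : ∀ {z h} → p z ≡ just h → z ∈ₑ h
    val {z} eq with z ≟ w | z ≟ u
    val refl | no _ | yes refl = u∈
    val eq   | no _ | no _     = valid M eq
    inj′ : ∀ {y z h} → p y ≡ just h → p z ≡ just h → y ≡ z
    inj′ {y} {z} ey ez with y ≟ w | y ≟ u | z ≟ w | z ≟ u
    inj′ ey ez     | no _   | yes refl | no _   | yes refl = refl
    inj′ refl ez   | no _   | yes _    | no z≢w | no _     = contradiction (inj M ez σw) z≢w
    inj′ ey refl   | no y≢w | no _     | no _   | yes _    = contradiction (inj M ey σw) y≢w
    inj′ ey ez     | no _   | no _     | no _   | no _     = inj M ey ez
    M′ : PartialMatching
    M′ = record { partner = p ; valid = val ; inj = inj′ }
    free-w : p w ≡ nothing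
    free-w with w ≟ w
    ... | yes _ = refl
    ... | no w≢w = contradiction refl w≢w
    u≢w : u ≢ w
    u≢w refl with () ← trans (sym fr) σw
    pu : p u ≡ just g
    pu with u ≟ w | u ≟ u
    ... | yes e | _ = contradiction e u≢w
    ... | no _ | yes _ = refl
    ... | no _ | no u≢u = contradiction refl u≢u
    same : ∀ z → z ≢ w → z ≢ u → p z ≡ partner M z
    same z z≢w z≢u with z ≟ w | z ≟ u
    ... | yes e | _     = contradiction e z≢w
    ... | no _  | yes e = contradiction e z≢u
    ... | no _  | no _  = refl
    keep : ∀ {h} → Covers M h → Covers M′ h
    keep (z , eq) with z ≟ w | z ≟ u
    ... | yes refl | _ with refl ← trans (sym σw) eq = u , pu
    ... | no _ | yes refl with () ← trans (sym fr) eq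
    keep (z , eq) | no z≢w | no z≢u = z , trans (same z z≢w z≢u) eq
    unkeep : ∀ {h} → Covers M′ h → Covers M h
    unkeep (z , eq) with z ≟ w | z ≟ u
    unkeep (z , refl) | no _ | yes refl = w , σw
    unkeep (z , eq)   | no _ | no _     = z , eq

-- Matching all hyperedges to distinct vertices.

module Hall {r n : ℕ} (H : Hypergraph r n) (free : BergePathFree H (suc r))
  (conn : Connected H) (2≤r : 2 ≤ r) (n-large : suc r * suc r < n) where

  open BergePaths H
  open PartialMatchings H
  module Mat (M : PartialMatching) = Matching H free (partner M) (valid M) (inj M)
  module Las (M : PartialMatching) = Lassos H free (partner M) (valid M) (inj M)

  private
    transport : ∀ M M′ {x v l} → (∀ {z} → z ∈ l → partner M′ z ≡ partner M z) →
                Mat.DPath M x v l → Mat.DPath M′ x v l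
    transport M M′ same Mat.nil = Mat.nil
    transport M M′ same (Mat.snoc p (f , eq , v∈)) =
      Mat.snoc (transport M M′ (same ∘ there) p) (f , trans (same (here refl)) eq , v∈)

  -- Shifting from the free end back to `x` releases `x` for `f`. Each shift alters only the last
  -- two vertices, so the rest of the path stays directed for the new matching.
  augment : ∀ M {x u} l → Mat.DPath M x u l → Unique (u ∷ l) → Free M u →
            ∀ {f} → x ∈ₑ f → ¬ Covers M f → ∃ λ M′ → Covers M′ f × (∀ {g} → Covers M g → Covers M′ g)
  augment M [] Mat.nil uq fr x∈ unc = assign M unc fr x∈
  augment M (w ∷ l) (Mat.snoc p (g , eq , u∈)) uq@(_ ∷ uq′) fr x∈ unc
    with M₁ , free-w , keep , unkeep , same ← shift M eq fr u∈
    with M₂ , cov , keep₂ ← augment M₁ l (transport M M₁ (λ {z} z∈ → same z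
           (λ { refl → Unique[x∷xs]⇒x∉xs uq′ z∈ }) (λ { refl → Unique[x∷xs]⇒x∉xs uq (there z∈) })) p)
           uq′ free-w x∈ (unc ∘ unkeep)
    = M₂ , cov , keep₂ ∘ keep

  cover : ∀ fs → ∃ λ M → ∀ {f} → f ∈ fs → Covers M f
  cover [] = empty , λ ()
  cover (f ∷ fs) with M , cov ← cover fs with covers? M f
  ... | yes c = M , λ { (here refl) → c ; (there g∈) → cov g∈ }
  ... | no unc = augmented
    where
    x : ∃ λ x → x ∈ₑ f
    x = nonempty (members (edge H f)) (≤-trans (ℕₚ.<⇒≤ 2≤r) (≤-reflexive (sym (length-edge f))))
    -- With `Y` empty the lasso is a cycle containing its r-element hoop, which is too long. Hence
    -- `reach` can stop only at a free vertex.
    noLasso : ∀ (L : Las.Lasso M []) → ⊥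
    noLasso L = ℕₚ.<⇒≱ (Mat.cycle-short M conn 2≤r n-large
                    (record { path = path L ; close = hoop L , label L , head∈ L ; unique = unique L }))
                  (edge≤ (hoop L) (λ v∈ → [ (λ ()) , id ]′ (closed L v∈)))
      where open Las.Lasso
    freeVertices : List V
    freeVertices = filter (free? M) (allFin n)
    augmented : ∃ λ M′ → ∀ {g} → g ∈ f ∷ fs → Covers M′ g
    augmented with z , l , p , uq , _ , z∈ ← Las.reach M {Y = []} {Z = freeVertices} (λ L → ⊥-elim (noLasso L))
                     (λ {x} eq → ∈-filter⁺ (free? M) (∈-allFin x) eq) (suc r) {x₀ = proj₁ x} {l = []}
                     Mat.nil ([] ∷ []) (λ ()) (s≤s (ℕₚ.m≤m+n r 0))
      with M′ , cov-f , keep ← augment M l p uq (proj₂ (∈-filter⁻ (free? M) {xs = allFin n} z∈)) (proj₂ x) unc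
      = M′ , λ { (here refl) → cov-f ; (there g∈) → keep (cov g∈) }

  perfect : ∃ λ M → ∀ f → Covers M f
  perfect with M , cov ← cover (allFin (m H)) = M , λ f → cov (∈-allFin f)

  freeVertices-length : ∀ M → (∀ f → Covers M f) → length (filter (free? M) (allFin n)) + m H ≤ n
  freeVertices-length M cov = ≤-trans (≤-reflexive (sym (trans (length-++ U) (cong (length U +_)
      (trans (length-map rep (allFin (m H))) (length-tabulate id))))))
    (unique-length≤ (Uniqueₚ.++⁺ (Uniqueₚ.filter⁺ (free? M) (Uniqueₚ.allFin⁺ n))
      (Uniqueₚ.map⁺ rep-inj (Uniqueₚ.allFin⁺ (m H))) disjoint))
    where
    U : List V
    U = filter (free? M) (allFin n)
    rep : E → V
    rep f = proj₁ (cov f)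
    rep-inj : ∀ {f g} → rep f ≡ rep g → f ≡ g
    rep-inj {f} {g} eq = just-injective (trans (sym (proj₂ (cov f))) (trans (cong (partner M) eq) (proj₂ (cov g))))
    disjoint : Disjoint U (map rep (allFin (m H)))
    disjoint (a , b) with f , _ , refl ← ∈-map⁻ rep b
      with () ← trans (sym (proj₂ (∈-filter⁻ (free? M) {xs = allFin n} a))) (proj₂ (cov f))

-- Growing and linking the core.

module Cores {r n : ℕ} (H : Hypergraph r n) (free : BergePathFree H (suc r))
  (σ : Fin n → Maybe (Fin (m H)))
  (σ-valid : ∀ {x f} → σ x ≡ just f → x ∈ members (edge H f))
  (σ-inj : ∀ {x y f} → σ x ≡ just f → σ y ≡ just f → x ≡ y) where

  open BergePaths H
  open Matching H free σ σ-valid σ-inj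
  open Lassos H free σ σ-valid σ-inj

  -- The paths to different targets may share vertices, and a target may itself lie in `X`.
  Reaches : List V → List V → V → Set
  Reaches X Y x = x ∉ X × x ∉ Y ×
    (∀ {y} → y ∈ Y → ∃ λ l → DPath x y l × Unique (y ∷ l) × Disjoint l X × Disjoint l Y)

  -- Rich Y μ says that no μ vertices can cut Y off from all common sources.
  Rich : List V → ℕ → Set
  Rich Y μ = ∀ X → length X ≤ μ → ¬ ¬ ∃ (Reaches X Y)

  module _ (short : ∀ {x l} → Cycle x l → suc (length l) < r)
           (U : List V) (free∈U : ∀ {x} → σ x ≡ nothing → x ∈ U) (U≤r : length U ≤ r) where

    private
      module Blocked {Y : List V} {μ : ℕ} {Z : List V} (hits : ∀ (L : Lasso Y) → Hits Z L)
        (Z≤ : length Z ≤ hitBound r) (free∈Z : ∀ {x} → σ x ≡ nothing → x ∈ Z)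
        (B : V → List V) (B≤ : ∀ z → length (B z) ≤ μ)
        (blocked : ∀ {z} → z ∉ Y → ∀ x → ¬ Reaches (B z) (z ∷ Y) x) where

        -- One stage is consumed per step of `descend`; directed paths have at most r arcs, so the
        -- stages up to r + 1 are enough.
        closure : ℕ → List V
        closure zero    = Z
        closure (suc j) = closure j ++ concatMap B (closure j)

        closure-length : ∀ j → length (closure j) ≤ hitBound r * suc μ ^ j
        closure-length zero    = ≤-trans Z≤ (≤-reflexive (sym (ℕₚ.*-identityʳ _)))
        closure-length (suc j) = ≤-trans (≤-reflexive (length-++ (closure j)))
          (≤-trans (ℕₚ.+-monoʳ-≤ _ (length-concatMap≤ B B≤ (closure j)))
          (≤-trans (≤-reflexive (sym (ℕₚ.*-suc (length (closure j)) μ)))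
          (≤-trans (ℕₚ.*-monoˡ-≤ (suc μ) (closure-length j))
            (≤-reflexive (trans (ℕₚ.*-assoc (hitBound r) _ _) (cong (hitBound r *_) (ℕₚ.*-comm (suc μ ^ j) (suc μ))))))))

        closure-mono : ∀ {i j} → i ≤ j → closure i ⊆ closure j
        closure-mono {j = j} i≤j with ℕₚ.m≤n⇒m<n∨m≡n i≤j
        ... | inj₂ refl = id
        closure-mono {j = suc j} _ | inj₁ (s≤s i≤j) = ∈-++⁺ˡ ∘ closure-mono i≤j

        -- Walking back from z towards x₀, the blocking set of z contains an earlier vertex,
        -- which lies in the next closure and is blocked in turn.
        descend : ∀ {x₀} → Reaches (closure (suc r)) Y x₀ → ∀ fuel {z l} j → length l ≤ fuel →
                  DPath x₀ z l → Unique (z ∷ l) → Disjoint (z ∷ l) Y → z ∈ closure j → j + length l ≤ suc r → ⊥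
        descend (x₀∉ , _) _ j _ nil _ _ z∈ j≤ = x₀∉ (closure-mono (≤-trans (ℕₚ.m≤m+n j 0) j≤) z∈)
        descend {x₀} R@(x₀∉ , x₀∉Y , paths) (suc fuel) {z} {l} j (s≤s l≤) p@(snoc {u = w} {l = l₀} p₀ _) uq@(_ ∷ uq′) dis z∈ j≤
          with Any.any? (_∈? B z) l
        -- Here `x₀` reaches `z` along the current path and `Y` along its own paths, all avoiding
        -- `B z`, against the choice of `B z`.
        ... | no none = blocked (λ z∈Y → dis (here refl , z∈Y)) x₀
              ( (λ x₀∈B → none (lose x₀∈l x₀∈B))
              , ∉-∷ (λ { refl → Unique[x∷xs]⇒x∉xs uq x₀∈l }) x₀∉Y
              , λ { (here refl) → l , p , uq , (λ (a , b) → none (lose a b))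
                                , λ { (a , here refl) → Unique[x∷xs]⇒x∉xs uq a ; (a , there b) → dis (there a , b) }
                  ; (there y∈) → widened (paths y∈) })
          where
          x₀∈l : x₀ ∈ w ∷ l₀
          x₀∈l = source∈ p₀
          next : closure (suc j) ⊆ closure (suc r)
          next = closure-mono (≤-trans (s≤s (ℕₚ.m≤m+n j (length l₀))) (≤-trans (≤-reflexive (sym (ℕₚ.+-suc j (length l₀)))) j≤))
          widened : ∀ {y} → (∃ λ l → DPath x₀ y l × Unique (y ∷ l) × Disjoint l (closure (suc r)) × Disjoint l Y) →
                    ∃ λ l → DPath x₀ y l × Unique (y ∷ l) × Disjoint l (B z) × Disjoint l (z ∷ Y)
          widened (l′ , p′ , uql′ , disX , disY) = l′ , p′ , uql′
            , (λ (a , b) → disX (a , next (∈-++⁺ʳ (closure j) (∈-concatMap⁺ B (lose z∈ b)))))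
            , λ { (a , here refl) → disX (a , next (∈-++⁺ˡ z∈)) ; (a , there b) → disY (a , b) }
        ... | yes some with u , u∈l , u∈B ← find some with q , l′ , p′ , eq ← prefix p₀ u∈l =
          descend R fuel (suc j) (≤-trans l′≤ l≤) p′ (unique-++⁻ʳ q (subst Unique eq uq′))
            (λ (a , b) → dis (there (subst (_ ∈_) (sym eq) (∈-++⁺ʳ q a)) , b))
            (∈-++⁺ʳ (closure j) (∈-concatMap⁺ B (lose z∈ u∈B)))
            (≤-trans (≤-reflexive (sym (ℕₚ.+-suc j (length l′)))) (≤-trans (ℕₚ.+-monoʳ-≤ j (s≤s l′≤)) j≤))
          where
          l′≤ : length l′ ≤ length l₀
          l′≤ = ℕₚ.≤-pred (≤-trans (ℕₚ.m≤n+m (suc (length l′)) (length q))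
                  (≤-reflexive (trans (sym (length-++ q)) (cong length (sym eq)))))

    -- Otherwise every `z` outside `Y` has a blocking set of size at most `μ`. Richness yields a
    -- source outside the closure of `U ++ Z` under these sets; `reach` still leads from it to
    -- `U ++ Z`, which `descend` refutes. The demand on `Y` is the size of the closure at stage r +
    -- 1.
    grow : ∀ {Y μ} → Unique Y → 2 + length Y ≤ r → Rich Y (hitBound r * suc μ ^ suc r) →
           ¬ ¬ (∃ λ z → z ∉ Y × Rich (z ∷ Y) μ)
    grow {Y} {μ} uqY len rich none =
      transversal {Y} short [] Y (λ ()) id [] uqY (λ ()) len λ (Z , Z≤ , hit) →
      ¬¬-finite-choice block λ blocks →
        let B = λ z → proj₁ (blocks z)
            hits : ∀ (L : Lasso Y) → Hits (U ++ Z) L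
            hits L = Any.map (∈-++⁺ʳ U) (hit L (λ ()) (inj₂ ∘ Lasso.closed L))
            Z′≤ : length (U ++ Z) ≤ hitBound r
            Z′≤ = ≤-trans (≤-reflexive (length-++ U)) (ℕₚ.+-mono-≤ U≤r
                    (≤-trans Z≤ (ℕₚ.*-monoˡ-≤ (traceBound r) (ℕₚ.^-monoʳ-≤ 2 (≤-trans (ℕₚ.m≤n+m (length Y) 2) len)))))
            open Blocked {Y} {μ} hits Z′≤ (∈-++⁺ˡ ∘ free∈U) B (λ z → proj₁ (proj₂ (blocks z)))
                   (λ {z} → proj₂ (proj₂ (blocks z)))
        in rich (closure (suc r)) (closure-length (suc r)) λ (x₀ , R) →
           let z , l , p , uq , dis , z∈ = reach {Y} {U ++ Z} hits (∈-++⁺ˡ ∘ free∈U) (suc r) nil ([] ∷ [])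
                 (λ { (here refl , b) → proj₁ (proj₂ R) b }) (s≤s (ℕₚ.m≤m+n r 0))
           in descend R (length l) 0 ≤-refl p uq dis z∈ (≤-trans (dpath-length p uq) (ℕₚ.n≤1+n r))
      where
      block : ∀ z → ¬ ¬ (∃ λ X → length X ≤ μ × (z ∉ Y → ∀ x → ¬ Reaches X (z ∷ Y) x))
      block z none′ with z ∈? Y
      ... | yes z∈ = none′ ([] , z≤n , λ z∉ → contradiction z∈ z∉)
      ... | no z∉  = none (z , z∉ , λ X X≤ empty → none′ (X , X≤ , λ _ x R → empty (x , R)))

  -- Walks back from v towards x up to the first u ∈ l₂, skips u by using its hyperedge directly,
  -- and follows l₂ from there to y.
  link : ∀ {x v l y l₂ X k} → DPath x v l → DPath x y l₂ → MPath v X k → Unique l → Unique (y ∷ l₂) →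
         Disjoint l (v ∷ X) → Disjoint l₂ X → v ∉ l₂ → v ≢ y → y ∉ v ∷ X → y ∉ l →
         ∃₂ λ X′ k′ → MPath y X′ k′ × k < k′ × X′ ⊆ v ∷ l ++ l₂ ++ X
  link nil p₂ P uq uq₂ dis dis₂ v∉ v≢y y∉X y∉l with source∈ p₂
  ... | here e = contradiction e v≢y
  ... | there x∈ = contradiction x∈ v∉
  link {v = v} {y = y} {l₂} {X} {k} (snoc {u = u} {l = l} p (f , eq , v∈)) p₂ P uq@(_ ∷ uq′) uq₂@(_ ∷ uql₂) dis dis₂ v∉ v≢y y∉X y∉l
    with u ∈? l₂
  ... | no u∉ with X′ , k′ , P′ , k< , sub ← link p p₂
                     (mstep P eq v∈ (σ-valid eq) (λ u∈ → dis (here refl , there u∈)) (λ u∈ → dis (here refl , u∈)))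
                     uq′ uq₂
                     (λ { (a , here refl) → Unique[x∷xs]⇒x∉xs uq a
                        ; (a , there (here refl)) → dis (there a , here refl)
                        ; (a , there (there (here refl))) → Unique[x∷xs]⇒x∉xs uq a
                        ; (a , there (there (there b))) → dis (there a , there b) })
                     (λ { (a , here refl) → v∉ a ; (a , there (here refl)) → u∉ a ; (a , there (there b)) → dis₂ (a , b) })
                     u∉ (λ { refl → y∉l (here refl) })
                     (∉-∷ (λ { refl → y∉l (here refl) }) (∉-∷ (λ { refl → y∉X (here refl) })
                        (∉-∷ (λ { refl → y∉l (here refl) }) (y∉X ∘ there))))
                     (y∉l ∘ there)
      = X′ , k′ , P′ , ≤-trans (ℕₚ.n≤1+n _) k< , sub′ ∘ sub
    where
    sub′ : u ∷ l ++ l₂ ++ v ∷ u ∷ X ⊆ v ∷ u ∷ l ++ l₂ ++ X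
    sub′ (here e) = there (here e)
    sub′ (there a) with ∈-++⁻ l a
    ... | inj₁ b = there (there (∈-++⁺ˡ b))
    ... | inj₂ b with ∈-++⁻ l₂ b
    ... | inj₁ c = there (there (∈-++⁺ʳ l (∈-++⁺ˡ c)))
    ... | inj₂ (here e) = here e
    ... | inj₂ (there (here e)) = there (here e)
    ... | inj₂ (there (there c)) = there (there (∈-++⁺ʳ l (∈-++⁺ʳ l₂ c)))
  ... | yes u∈ with w , l₁ , l₃ , (g , eq′ , w∈) , p₁ , refl ← suffix p₂ u∈ with refl ← trans (sym eq) eq′ =
    _ , _ , mforward (mstep P eq v∈ w∈ (λ u∈X → dis (here refl , there u∈X)) (w∉ (source∈ p₁))) p₁ (unique-++⁻ˡ (y ∷ l₁) uq₂)
      (λ { (here refl , here e) → y∉X (here e) ; (here refl , there (here e)) → y∉l (here e)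
         ; (here refl , there (there b)) → y∉X (there b)
         ; (there a , here refl) → v∉ (∈-++⁺ˡ a) ; (there a , there (here refl)) → unique-++⁻-disjoint l₁ uql₂ (a , here refl)
         ; (there a , there (there b)) → dis₂ (∈-++⁺ˡ a , b) })
    , ≤-trans (ℕₚ.m≤n+m (suc k) (length l₁)) ≤-refl , sub
    where
    w∉ : ∀ {w} → w ∈ y ∷ l₁ → w ∉ v ∷ X
    w∉ (here refl) = y∉X
    w∉ (there a)   = ∉-∷ (λ { refl → v∉ (∈-++⁺ˡ a) }) (λ b → dis₂ (∈-++⁺ˡ a , b))
    sub : l₁ ++ v ∷ u ∷ X ⊆ v ∷ u ∷ l ++ (l₁ ++ u ∷ l₃) ++ X
    sub a with ∈-++⁻ l₁ a
    ... | inj₁ b = there (there (∈-++⁺ʳ l (∈-++⁺ˡ (∈-++⁺ˡ b))))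
    ... | inj₂ (here e) = here e
    ... | inj₂ (there (here e)) = there (here e)
    ... | inj₂ (there (there b)) = there (there (∈-++⁺ʳ l (∈-++⁺ʳ (l₁ ++ u ∷ l₃) b)))

  -- Consecutive core vertices are joined through a common source. Each link uses at least one
  -- hyperedge and adds at most 2r + 1 recorded vertices. From the last core vertex one more arc is
  -- followed backwards.
  linkAll : ∀ {Y μ} → Rich Y μ → ∀ R {y X k} → Unique (y ∷ R) → y ∷ R ⊆ Y → Disjoint R X →
            MPath y X k → length X + suc (length R) * suc (r + r) ≤ μ → r < k + suc (length R) → ⊥
  linkAll {Y} rich [] {y} {X} {k} uq sub dis P X≤ long =
    rich X (≤-trans (ℕₚ.m≤m+n _ _) X≤) λ (x , x∉X , x∉Y , paths) → finish x∉Y (paths (sub (here refl)))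
    where
    finish : ∀ {x} → x ∉ Y → (∃ λ l → DPath x y l × Unique (y ∷ l) × Disjoint l X × Disjoint l Y) → ⊥
    finish x∉Y (_ , nil , _) = x∉Y (sub (here refl))
    finish x∉Y (_ , snoc p (f , eq , y∈) , uq , disX , disY) =
      ℕₚ.<⇒≱ (≤-trans long (≤-reflexive (ℕₚ.+-comm k 1)))
        (noPath (mstep P eq y∈ (σ-valid eq) (λ u∈ → disX (here refl , u∈))
          (∉-∷ (λ { refl → Unique[x∷xs]⇒x∉xs uq (here refl) }) (λ u∈ → disX (here refl , u∈)))))
  linkAll {Y} {μ} rich (y′ ∷ R) {y} {X} {k} uq@(_ ∷ uq′) sub dis P X≤ long =
    rich X (≤-trans (ℕₚ.m≤m+n _ _) X≤) λ (x , x∉X , x∉Y , paths) →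
      continue (paths (sub (here refl))) (paths (sub (there (here refl))))
    where
    continue : ∀ {x} → (∃ λ l → DPath x y l × Unique (y ∷ l) × Disjoint l X × Disjoint l Y) →
               (∃ λ l → DPath x y′ l × Unique (y′ ∷ l) × Disjoint l X × Disjoint l Y) → ⊥
    continue (l , p , uql@(_ ∷ uql′) , disX , disY) (l₂ , p₂ , uql₂ , disX₂ , disY₂)
      with X′ , k′ , P′ , k< , X′⊆ ← link p p₂ P uql′ uql₂
             (λ { (a , here refl) → Unique[x∷xs]⇒x∉xs uql a ; (a , there b) → disX (a , b) }) disX₂
             (λ y∈ → disY₂ (y∈ , sub (here refl))) (λ { refl → Unique[x∷xs]⇒x∉xs uq (here refl) })
             (∉-∷ (λ { refl → Unique[x∷xs]⇒x∉xs uq (here refl) }) (λ b → dis (here refl , b)))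
             (λ a → disY (a , sub (there (here refl))))
      = linkAll rich R uq′ (sub ∘ there) dis′ (widen X′⊆ P′) size′
          (≤-trans long (≤-trans (≤-reflexive (ℕₚ.+-suc k _)) (ℕₚ.+-monoˡ-≤ _ k<)))
      where
      dis′ : Disjoint R (y ∷ l ++ l₂ ++ X)
      dis′ (a , here refl) = Unique[x∷xs]⇒x∉xs uq (there a)
      dis′ (a , there b) with ∈-++⁻ l b
      ... | inj₁ c = disY (c , sub (there (there a)))
      ... | inj₂ c with ∈-++⁻ l₂ c
      ... | inj₁ d = disY₂ (d , sub (there (there a)))
      ... | inj₂ d = dis (there a , d)
      size′ : length (y ∷ l ++ l₂ ++ X) + suc (length R) * suc (r + r) ≤ μ
      size′ = ≤-trans (ℕₚ.+-monoˡ-≤ (suc (length R) * suc (r + r))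
          (s≤s (≤-trans (≤-reflexive (trans (length-++ l) (cong (length l +_) (length-++ l₂))))
            (≤-trans (≤-reflexive (sym (ℕₚ.+-assoc (length l) _ _)))
              (ℕₚ.+-monoˡ-≤ (length X) (ℕₚ.+-mono-≤ (dpath-length p uql) (dpath-length p₂ uql₂)))))))
        (≤-trans (≤-reflexive arith) X≤)
        where
        arith : suc (r + r + length X) + suc (length R) * suc (r + r) ≡ length X + suc (suc (length R)) * suc (r + r)
        arith = solve 3 (λ a b c → (con 1 :+ (a :+ a :+ b)) :+ (con 1 :+ c) :* (con 1 :+ (a :+ a))
                               := b :+ (con 1 :+ (con 1 :+ c)) :* (con 1 :+ (a :+ a))) refl r (length X) (length R)

  Pendant : List V → List V → Set
  Pendant X Y = ∃₂ λ x f → x ∉ X × x ∉ Y × σ x ≡ just f × Y ⊆ members (edge H f)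

  -- A path of two or more arcs from the source to a core vertex would extend to one that is too
  -- long. So every vertex of `Y` is one arc away and lies in the hyperedge matched to the source.
  pendant : ∀ {Y μ} → Rich Y μ → pendantBound r ≤ μ → Unique Y → suc (length Y) ≡ r → 1 ≤ length Y →
            ∀ X → length X ≤ μ → ¬ ¬ Pendant X Y
  pendant {Y} {μ} rich ≤μ uqY lenY 1≤ X X≤ none = rich X X≤ λ (x , x∉X , x∉Y , paths) → impossible x∉X x∉Y paths
    where
    -- A tail of two vertices before y, all of Y and one vertex after it make r + 2 vertices.
    long⊥ : ∀ {x y l} → DPath x y l → Unique (y ∷ l) → Disjoint l Y → y ∈ Y → 2 ≤ length l → ⊥
    long⊥ {x} {y} {l} p uq dis y∈ 2≤ with Y₁ , Y₂ , refl ← ∈-∃++ y∈ =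
      linkAll rich (Y₁ ++ Y₂) (unique-∷ (unique-mid∉ Y₁ uqY) (unique-drop-mid Y₁ uqY))
        (λ { (here e) → ∈-++⁺ʳ Y₁ (here e) ; (there a) → [ ∈-++⁺ˡ , ∈-++⁺ʳ Y₁ ∘ there ]′ (∈-++⁻ Y₁ a) })
        (λ (a , b) → dis (b , [ ∈-++⁺ˡ , ∈-++⁺ʳ Y₁ ∘ there ]′ (∈-++⁻ Y₁ a)))
        (widen (λ v∈ → [ id , (λ ()) ]′ (∈-++⁻ l v∈)) (mforward {X = []} start p uq λ ()))
        (≤-trans (ℕₚ.+-mono-≤ (dpath-length p uq) (ℕₚ.*-monoˡ-≤ (suc (r + r)) (≤-trans (ℕₚ.n≤1+n _) (≤-reflexive lenR)))) ≤μ)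
        (≤-trans (≤-reflexive (cong suc (sym lenR))) (≤-trans (ℕₚ.+-monoˡ-≤ (suc (length (Y₁ ++ Y₂))) 2≤)
          (ℕₚ.+-monoˡ-≤ (suc (length (Y₁ ++ Y₂))) (ℕₚ.m≤m+n (length l) 0))))
      where
      lenR : suc (suc (length (Y₁ ++ Y₂))) ≡ r
      lenR = trans (cong suc (trans (cong suc (length-++ Y₁)) (sym (trans (length-++ Y₁) (ℕₚ.+-suc (length Y₁) (length Y₂)))))) lenY
    impossible : ∀ {x} → x ∉ X → x ∉ Y →
      (∀ {y} → y ∈ Y → ∃ λ l → DPath x y l × Unique (y ∷ l) × Disjoint l X × Disjoint l Y) → ⊥
    impossible {x} x∉X x∉Y paths with σ x in eq
    -- A source outside `Y` has an outgoing arc towards `Y`, so it is matched.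
    ... | nothing = unmatched (nonempty Y 1≤)
      where
      unmatched : (∃ λ y → y ∈ Y) → ⊥
      unmatched (y , y∈) with l , p , _ ← paths y∈ with source∈ p
      ... | here refl = x∉Y y∈
      ... | there x∈ with _ , _ , _ , (_ , eq′ , _) , _ ← suffix p x∈ with () ← trans (sym eq) eq′
    ... | just f with Any.any? (λ y → ¬? (y ∈? members (edge H f))) Y
    ... | no all = none (x , f , x∉X , x∉Y , eq , Y⊆f)
      where
      Y⊆f : Y ⊆ members (edge H f)
      Y⊆f {y} y∈ with y ∈? members (edge H f)
      ... | yes p = p
      ... | no ¬p = contradiction (lose y∈ ¬p) all
    ... | yes some with y , y∈ , y∉f ← find some with paths y∈
    ... | _ , nil , _ = x∉Y y∈
    ... | _ , snoc nil (g , eq′ , y∈g) , _ with refl ← trans (sym eq) eq′ = y∉f y∈g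
    ... | _ , p@(snoc (snoc _ _) _) , uq , _ , disY = long⊥ p uq disY y∈ (s≤s (s≤s z≤n))

-- Hyperedges pendant on the core.

module PendantEdges {r n : ℕ} (H : Hypergraph r n) (free : BergePathFree H (suc r)) (conn : Connected H)
  (K : List (Fin n)) (uqK : Unique K) (lenK : suc (length K) ≡ r) (1≤K : 1 ≤ length K)
  (pendants : ∀ VS ES → length VS + length ES ≤ 4 + 2 * r →
     ¬ ¬ ∃₂ λ x f → x ∉ VS × x ∉ K × f ∉ ES × x ∈ members (edge H f) × K ⊆ members (edge H f)) where

  open BergePaths H
  -- The empty matching serves: these lemmas concern only `H` and its freeness.
  open Matching H free (λ _ → nothing) (λ ()) (λ ()) using (noPath; edge-fill; edge-ext; outside-edge?)

  -- Fresh pendant hyperedges contain all of `K`, so they carry the path through the rest of `K` and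
  -- finally out to a pendant vertex. Each step records one vertex and one hyperedge, hence the
  -- factor 2.
  sweep : ∀ R {c VS ES k} → Path c VS ES k → Unique (c ∷ R) → c ∷ R ⊆ K → Disjoint R VS →
          suc (length VS) + length ES + 2 * length R ≤ 4 + 2 * r → r < k + suc (length R) → ⊥
  sweep [] {c} {VS} {ES} {k} P uq sub dis size≤ long =
    pendants (c ∷ VS) ES (≤-trans (ℕₚ.m≤m+n _ _) size≤) λ (x , f , x∉ , x∉K , f∉ , x∈ , K⊆f) →
      ℕₚ.<⇒≱ (≤-trans long (≤-reflexive (ℕₚ.+-comm k 1))) (noPath (step f P (K⊆f (sub (here refl))) x∈ x∉ f∉))
  sweep (c′ ∷ R) {c} {VS} {ES} {k} P uq@(_ ∷ uq′) sub dis size≤ long =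
    pendants (c ∷ VS) ES (≤-trans (ℕₚ.m≤m+n _ _) size≤) λ (x , f , x∉ , x∉K , f∉ , x∈ , K⊆f) →
      sweep R (step f P (K⊆f (sub (here refl))) (K⊆f (sub (there (here refl))))
                 (∉-∷ (λ { refl → Unique[x∷xs]⇒x∉xs uq (here refl) }) (λ c′∈ → dis (here refl , c′∈))) f∉)
        uq′ (sub ∘ there) (λ { (a , here refl) → Unique[x∷xs]⇒x∉xs uq (there a) ; (a , there b) → dis (there a , b) })
        (≤-trans (≤-reflexive (arith (length VS) (length ES) (length R))) size≤) (≤-trans long (≤-reflexive (ℕₚ.+-suc k _)))
    where
    arith : ∀ a b c → suc (suc a) + suc b + 2 * c ≡ suc a + b + 2 * suc c
    arith = solve 3 (λ a b c → con 2 :+ a :+ (con 1 :+ b) :+ con 2 :* c := con 1 :+ a :+ b :+ con 2 :* (con 1 :+ c)) refl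

  -- z – h – y – g – c followed by the rest of K and a pendant vertex has r + 1 hyperedges.
  noTail : ∀ {z y c g h} → c ∈ K → c ∈ₑ g → y ∈ₑ g → y ∈ₑ h → z ∈ₑ h → y ∉ K → z ∉ K → z ≢ y → h ≢ g → ⊥
  noTail {z} {y} {c} {g} {h} c∈K c∈g y∈g y∈h z∈h y∉K z∉K z≢y h≢g with K₁ , K₂ , refl ← ∈-∃++ c∈K =
    sweep (K₁ ++ K₂)
      (step g (step h (start {VS = []} {[]}) z∈h y∈h (∉-∷ (z≢y ∘ sym) λ ()) λ ()) y∈g c∈g
        (∉-∷ (λ { refl → y∉K c∈K }) (∉-∷ (λ { refl → z∉K c∈K }) λ ())) (∉-∷ (h≢g ∘ sym) λ ()))
      (unique-∷ (unique-mid∉ K₁ uqK) (unique-drop-mid K₁ uqK))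
      (λ { (here e) → ∈-++⁺ʳ K₁ (here e) ; (there a) → rest a })
      (λ { (a , here refl) → y∉K (rest a) ; (a , there (here refl)) → z∉K (rest a) })
      (s≤s (s≤s (s≤s (s≤s (≤-trans (ℕₚ.n≤1+n _) (≤-trans (≤-reflexive (sym (ℕₚ.*-suc 2 _)))
        (ℕₚ.*-monoʳ-≤ 2 (≤-trans (ℕₚ.n≤1+n _) (≤-reflexive lenR)))))))))
      (≤-reflexive (cong suc (sym lenR)))
    where
    rest : ∀ {v} → v ∈ K₁ ++ K₂ → v ∈ K₁ ++ c ∷ K₂
    rest a = [ ∈-++⁺ˡ , ∈-++⁺ʳ K₁ ∘ there ]′ (∈-++⁻ K₁ a)
    lenR : suc (suc (length (K₁ ++ K₂))) ≡ r
    lenR = trans (cong suc (trans (cong suc (length-++ K₁)) (sym (trans (length-++ K₁) (ℕₚ.+-suc (length K₁) (length K₂)))))) lenK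

  -- If `h ≢ g`, a vertex of `h` outside `K ∪ {y}` is excluded by `noTail`, so `h` equals `K ∪ {y}`.
  -- Then `h` contains `c` too, and the same argument shows that `g` equals this set.
  degree1 : ∀ {y c g h} → c ∈ K → c ∈ₑ g → y ∉ K → y ∈ₑ g → y ∈ₑ h → h ≡ g
  degree1 {y} {c} {g} {h} c∈K c∈g y∉K y∈g y∈h with h ≟ g
  ... | yes e = e
  ... | no h≢g with outside-edge? h (y ∷ K)
  ... | inj₂ (z , z∈ , z∉) = ⊥-elim (noTail c∈K c∈g y∈g y∈h z∈ y∉K (z∉ ∘ there) (z∉ ∘ here) h≢g)
  ... | inj₁ h⊆ with outside-edge? g (y ∷ K)
  ... | inj₂ (z , z∈ , z∉) = ⊥-elim (noTail c∈K (edge-fill h h⊆ (≤-reflexive lenK) (there c∈K)) y∈h y∈g z∈ y∉K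
                               (z∉ ∘ there) (z∉ ∘ here) (h≢g ∘ sym))
  ... | inj₁ g⊆ = edge-ext (edge-fill g g⊆ (≤-reflexive lenK) ∘ h⊆) (edge-fill h h⊆ (≤-reflexive lenK) ∘ g⊆)

  Meets : E → Set
  Meets g = Any (_∈ₑ g) K

  Attached : V → Set
  Attached v = v ∈ K ⊎ ∃ λ g → v ∈ₑ g × Meets g

  attached? : Decidable Attached
  attached? v = v ∈? K ⊎-dec any? λ g → (v ∈? members (edge H g)) ×-dec Any.any? (_∈? members (edge H g)) K

  -- Otherwise some hyperedge `f` joins an attached `a` to an unattached `b`. If `a` lies in `K`,
  -- then `f` attaches `b`; if not, `degree1` identifies `f` with the hyperedge attaching `a`.
  attached : ∀ v → Attached v
  attached v with attached? v
  ... | yes a = a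
  ... | no ¬a with crossing conn attached? {proj₁ (nonempty K 1≤K)} {v} (inj₁ (proj₂ (nonempty K 1≤K))) ¬a
  ... | f , a , b , a∈f , b∈f , inj₁ a∈K , ¬b = ⊥-elim (¬b (inj₂ (f , b∈f , lose a∈K a∈f)))
  ... | f , a , b , a∈f , b∈f , inj₂ (g , a∈g , meets) , ¬b with a ∈? K
  ... | yes a∈K = ⊥-elim (¬b (inj₂ (f , b∈f , lose a∈K a∈f)))
  ... | no a∉K with c , c∈K , c∈g ← find meets with refl ← degree1 c∈K c∈g a∉K a∈g a∈f =
    ⊥-elim (¬b (inj₂ (g , b∈f , meets)))

  unique-edge : ∀ {v f g} → v ∉ K → v ∈ₑ f → v ∈ₑ g → f ≡ g
  unique-edge {v} v∉K v∈f v∈g with attached v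
  ... | inj₁ v∈K = contradiction v∈K v∉K
  ... | inj₂ (e , v∈e , meets) with c , c∈K , c∈e ← find meets =
    trans (degree1 c∈K c∈e v∉K v∈e v∈f) (sym (degree1 c∈K c∈e v∉K v∈e v∈g))

  outer : ∀ f → ∃ λ v → v ∈ₑ f × v ∉ K
  outer f with outside-edge? f K
  ... | inj₂ o  = o
  ... | inj₁ f⊆ = contradiction (≤-trans (≤-reflexive lenK) (edge≤ f f⊆)) ℕₚ.1+n≰n

  -- With r vertices against r - 1 in `K`, each hyperedge has a vertex outside `K`; by degree one
  -- these are distinct for distinct hyperedges.
  size-bound : length K + m H ≤ n
  size-bound = ≤-trans (≤-reflexive (sym (trans (length-++ K) (cong (length K +_)
      (trans (length-map rep (allFin (m H))) (length-tabulate id))))))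
    (unique-length≤ (Uniqueₚ.++⁺ uqK (Uniqueₚ.map⁺ rep-inj (Uniqueₚ.allFin⁺ (m H))) disjoint))
    where
    rep : E → V
    rep f = proj₁ (outer f)
    rep-inj : ∀ {f g} → rep f ≡ rep g → f ≡ g
    rep-inj {f} {g} eq = unique-edge (proj₂ (proj₂ (outer f))) (proj₁ (proj₂ (outer f)))
                           (subst (_∈ₑ g) (sym eq) (proj₁ (proj₂ (outer g))))
    disjoint : Disjoint K (map rep (allFin (m H)))
    disjoint (a , b) with f , _ , refl ← ∈-map⁻ rep b = proj₂ (proj₂ (outer f)) a

-- Richness thresholds and the upper bound.

level : ℕ → ℕ → ℕ
-- The base pays for the exclusions in `sweep` and for linking the core. The recurrence is the loss
-- of richness in `grow`, with `j` core vertices still to be added.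
level r zero    = 4 + 2 * r + pendantBound r
level r (suc j) = hitBound r * suc (level r j) ^ suc r

module UpperBound {q n : ℕ} (H : Hypergraph (suc q) n) (free : BergePathFree H (suc (suc q)))
  (conn : Connected H) (1≤q : 1 ≤ q) (n-large : suc (suc q) * suc (suc q) + level (suc q) q < n) where

  private
    r : ℕ
    r = suc q
    square<n : suc r * suc r < n
    square<n = ℕₚ.≤-<-trans (ℕₚ.m≤m+n _ _) n-large
    r≤n : r ≤ n
    r≤n = ≤-trans (ℕₚ.n≤1+n r) (≤-trans (ℕₚ.m≤m*n (suc r) (suc r)) (ℕₚ.<⇒≤ square<n))

  open BergePaths H
  open PartialMatchings H using (PartialMatching; Covers; partner; valid; inj; free?)
  open Hall H free conn (s≤s 1≤q) square<n using (perfect; freeVertices-length)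

  private
    M : PartialMatching
    M = proj₁ perfect
    covered : ∀ f → Covers M f
    covered = proj₂ perfect
    U : List V
    U = filter (free? M) (allFin n)

  open Matching H free (partner M) (valid M) (inj M) using (cycle-short)
  open Cores H free (partner M) (valid M) (inj M)

  climb : length U ≤ r → ∀ j Y → Unique Y → length Y + j ≡ q → Rich Y (level r j) →
          ¬ ¬ (∃ λ Y′ → Unique Y′ × length Y′ ≡ q × Rich Y′ (level r 0))
  climb U≤r zero Y uq len rich none = none (Y , uq , trans (sym (ℕₚ.+-identityʳ _)) len , rich)
  climb U≤r (suc j) Y uq len rich none =
    grow (cycle-short conn (s≤s 1≤q) square<n) U (λ {x} eq → ∈-filter⁺ (free? M) (∈-allFin x) eq) U≤r uq
      (s≤s (≤-trans (s≤s (ℕₚ.m≤m+n (length Y) j)) (≤-reflexive (trans (sym (ℕₚ.+-suc (length Y) j)) len)))) rich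
      λ (z , z∉ , rich′) →
        climb U≤r j (z ∷ Y) (unique-∷ z∉ uq) (trans (sym (ℕₚ.+-suc (length Y) j)) len) rich′ none

  -- With no targets every vertex outside `X` is a source, and `n-large` leaves one.
  rich-[] : Rich [] (level r q)
  rich-[] X X≤ none with v , v∉ ← fresh X (ℕₚ.≤-<-trans X≤ (ℕₚ.≤-<-trans (ℕₚ.m≤n+m _ _) n-large)) =
    none (v , v∉ , (λ ()) , λ ())

  core-bound : ∀ {K} → Unique K → length K ≡ q → Rich K (level r 0) → q + m H ≤ n
  core-bound {K} uqK lenK rich = subst (λ c → c + m H ≤ n) lenK size-bound
    where
    rep : E → V
    rep f = proj₁ (covered f)
    pendants : ∀ VS ES → length VS + length ES ≤ 4 + 2 * r →
      ¬ ¬ ∃₂ λ x f → x ∉ VS × x ∉ K × f ∉ ES × x ∈ₑ f × K ⊆ members (edge H f)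
    pendants VS ES size≤ none =
      pendant rich (ℕₚ.m≤n+m _ (4 + 2 * r)) uqK (cong suc lenK) (≤-trans 1≤q (≤-reflexive (sym lenK)))
        -- Excluding the partner of a hyperedge excludes the hyperedge, since the pendant vertex
        -- found is the partner of `f`.
        (VS ++ map rep ES)
        (≤-trans (≤-reflexive (trans (length-++ VS) (cong (length VS +_) (length-map rep ES)))) (≤-trans size≤ (ℕₚ.m≤m+n _ _)))
        λ (x , f , x∉ , x∉K , eq , K⊆f) →
          none (x , f , x∉ ∘ ∈-++⁺ˡ , x∉K
               , (λ f∈ → x∉ (∈-++⁺ʳ VS (subst (_∈ map rep ES) (inj M (proj₂ (covered f)) eq) (∈-map⁺ rep f∈))))
               , valid M eq , K⊆f)
    open PendantEdges H free conn K uqK (cong suc lenK) (≤-trans 1≤q (≤-reflexive (sym lenK))) pendants using (size-bound)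

  edges≤ : m H ≤ suc (n ∸ r)
  -- Deciding the inequality leaves a contradiction to derive, where the doubly negated core may be
  -- used. Having too many hyperedges also leaves at most r vertices unmatched.
  edges≤ with m H ≤? suc (n ∸ r)
  ... | yes m≤ = m≤
  ... | no m≰ = ⊥-elim (climb U≤r q [] [] refl rich-[] λ (K , uqK , lenK , rich) →
                  m≰ (ℕₚ.+-cancelˡ-≤ q _ _ (≤-trans (core-bound uqK lenK rich) (≤-reflexive (sym q+≡n)))))
    where
    q+≡n : q + suc (n ∸ r) ≡ n
    q+≡n = trans (ℕₚ.+-suc q (n ∸ r)) (ℕₚ.m+[n∸m]≡n r≤n)
    n≤r+m : n ≤ r + m H
    n≤r+m = ≤-trans (≤-reflexive (sym q+≡n)) (≤-trans (ℕₚ.+-monoʳ-≤ q (ℕₚ.<⇒≤ (ℕₚ.≰⇒> m≰))) (ℕₚ.n≤1+n _))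
    U≤r : length U ≤ r
    U≤r = ℕₚ.+-cancelʳ-≤ (m H) _ _ (≤-trans (freeVertices-length M covered) n≤r+m)

-- The extremal hypergraph.

∣⊤++∣ : ∀ q {p} (s : Subset p) → ∣ ⊤ {q} Vec.++ s ∣ ≡ q + ∣ s ∣
∣⊤++∣ zero    s = refl
∣⊤++∣ (suc q) s = cong suc (∣⊤++∣ q s)

↑ˡ∈⊤++ : ∀ {q p} (i : Fin q) (s : Subset p) → (i ↑ˡ p) ∈ₛ (⊤ {q} Vec.++ s)
↑ˡ∈⊤++ zero    s = Vec.here
↑ˡ∈⊤++ (suc i) s = Vec.there (↑ˡ∈⊤++ i s)

↑ʳ∈++⁺ : ∀ {q p} (t : Subset q) {s : Subset p} {j} → j ∈ₛ s → (q ↑ʳ j) ∈ₛ (t Vec.++ s)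
↑ʳ∈++⁺ []      j∈s = j∈s
↑ʳ∈++⁺ (_ ∷ t) j∈s = Vec.there (↑ʳ∈++⁺ t j∈s)

↑ʳ∈++⁻ : ∀ {q p} (t : Subset q) {s : Subset p} {j} → (q ↑ʳ j) ∈ₛ (t Vec.++ s) → j ∈ₛ s
↑ʳ∈++⁻ []      j∈            = j∈
↑ʳ∈++⁻ (_ ∷ t) (Vec.there j∈) = ↑ʳ∈++⁻ t j∈

module Book (q p : ℕ) where

  page : Fin p → Subset (q + p)
  page j = ⊤ {q} Vec.++ ⁅ j ⁆

  leaf∈page : ∀ j → (q ↑ʳ j) ∈ₛ page j
  leaf∈page j = ↑ʳ∈++⁺ ⊤ (x∈⁅x⁆ j)

  leaf∈page⇒≡ : ∀ {i j} → (q ↑ʳ i) ∈ₛ page j → i ≡ j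
  leaf∈page⇒≡ {i} {j} i∈ = x∈⁅y⁆⇒x≡y j (↑ʳ∈++⁻ (⊤ {q}) i∈)

  book : Hypergraph (suc q) (q + p)
  book = record
    { m        = p
    ; edge     = page
    ; edge-inj = λ {i} {j} eq → leaf∈page⇒≡ (subst ((q ↑ʳ i) ∈ₛ_) eq (leaf∈page i))
    ; uniform  = λ j → trans (∣⊤++∣ q ⁅ j ⁆) (trans (cong (q +_) (∣⁅x⁆∣≡1 j)) (ℕₚ.+-comm q 1))
    }

  trivialPath : ∀ x → BergePath book 0
  trivialPath x = record
    { vert      = λ _ → x
    ; vert-inj  = λ { {zero} {zero} _ → refl }
    ; hedge     = λ ()
    ; hedge-inj = λ { {()} }
    ; incident  = λ ()
    }

  edgePath : ∀ {x y} j → x ≢ y → x ∈ₛ page j → y ∈ₛ page j →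
             Σ (BergePath book 1) λ P → OnPath P x × OnPath P y
  edgePath {x} {y} j x≢y x∈ y∈ = P , (zero , refl) , (suc zero , refl)
    where
    P : BergePath book 1
    P = record
      { vert      = λ { zero → x ; (suc zero) → y }
      ; vert-inj  = λ { {zero} {zero} _ → refl
                      ; {zero} {suc zero} eq → contradiction eq x≢y
                      ; {suc zero} {zero} eq → contradiction (sym eq) x≢y
                      ; {suc zero} {suc zero} _ → refl }
      ; hedge     = λ _ → j
      ; hedge-inj = λ { {zero} {zero} _ → refl }
      ; incident  = λ { zero → x∈ , y∈ }
      }

  leafPath : ∀ {i j} → i ≢ j → (c : Fin q) →
             Σ (BergePath book 2) λ P → OnPath P (q ↑ʳ i) × OnPath P (q ↑ʳ j)
  leafPath {i} {j} i≢j c = P , (zero , refl) , (suc (suc zero) , refl)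
    where
    c≢ : ∀ {l} → c ↑ˡ p ≢ q ↑ʳ l
    c≢ {l} eq with () ← trans (sym (Finₚ.splitAt-↑ˡ q c p))
                              (trans (cong (splitAt q) eq) (Finₚ.splitAt-↑ʳ q p l))
    i≢j′ : q ↑ʳ i ≢ q ↑ʳ j
    i≢j′ eq = i≢j (Finₚ.↑ʳ-injective q i j eq)
    P : BergePath book 2
    P = record
      { vert      = λ { zero → q ↑ʳ i ; (suc zero) → c ↑ˡ p ; (suc (suc zero)) → q ↑ʳ j }
      ; vert-inj  = λ { {zero} {zero} _ → refl
                      ; {zero} {suc zero} eq → contradiction (sym eq) c≢
                      ; {zero} {suc (suc zero)} eq → contradiction eq i≢j′
                      ; {suc zero} {zero} eq → contradiction eq c≢
                      ; {suc zero} {suc zero} _ → refl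
                      ; {suc zero} {suc (suc zero)} eq → contradiction eq c≢
                      ; {suc (suc zero)} {zero} eq → contradiction (sym eq) i≢j′
                      ; {suc (suc zero)} {suc zero} eq → contradiction (sym eq) c≢
                      ; {suc (suc zero)} {suc (suc zero)} _ → refl }
      ; hedge     = λ { zero → i ; (suc zero) → j }
      ; hedge-inj = λ { {zero} {zero} _ → refl
                      ; {zero} {suc zero} eq → contradiction eq i≢j
                      ; {suc zero} {zero} eq → contradiction (sym eq) i≢j
                      ; {suc zero} {suc zero} _ → refl }
      ; incident  = λ { zero → leaf∈page i , ↑ˡ∈⊤++ c ⁅ i ⁆
                      ; (suc zero) → ↑ˡ∈⊤++ c ⁅ j ⁆ , leaf∈page j }
      }

  -- Two vertices share a page unless both are leaves; distinct leaves are joined through the spine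
  -- vertex `c₀`. The page `j₀` serves two spine vertices.
  book-connected : Fin q → Fin p → Connected book
  book-connected c₀ j₀ x y with x Finₚ.≟ y
  ... | yes refl = 0 , trivialPath x , (zero , refl) , (zero , refl)
  ... | no x≢y with splitAt q x in eqx | splitAt q y in eqy
  ... | inj₁ i | inj₁ j
        with refl ← splitAt⁻¹-↑ˡ eqx | refl ← splitAt⁻¹-↑ˡ eqy
        = 1 , edgePath j₀ x≢y (↑ˡ∈⊤++ i ⁅ j₀ ⁆) (↑ˡ∈⊤++ j ⁅ j₀ ⁆)
  ... | inj₁ i | inj₂ j
        with refl ← splitAt⁻¹-↑ˡ eqx | refl ← splitAt⁻¹-↑ʳ eqy
        = 1 , edgePath j x≢y (↑ˡ∈⊤++ i ⁅ j ⁆) (leaf∈page j)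
  ... | inj₂ i | inj₁ j
        with refl ← splitAt⁻¹-↑ʳ eqx | refl ← splitAt⁻¹-↑ˡ eqy
        = 1 , edgePath i x≢y (leaf∈page i) (↑ˡ∈⊤++ j ⁅ i ⁆)
  ... | inj₂ i | inj₂ j
        with refl ← splitAt⁻¹-↑ʳ eqx | refl ← splitAt⁻¹-↑ʳ eqy
        = 2 , leafPath (λ i≡j → x≢y (cong (q ↑ʳ_) i≡j)) c₀

  -- An inner vertex of a Berge path lies in two different hyperedges, so it is a spine vertex.
  book-free : BergePathFree book (suc (suc q))
  book-free P = ℕₚ.<-irrefl refl (injective⇒≤ {f = λ s → proj₁ (spine s)} spine-inj)
    where
    inner : Fin (suc q) → Fin (q + p)
    -- A path with q + 2 hyperedges has q + 1 inner vertices, one more than the spine.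
    inner s = vert P (suc (inject₁ s))
    spine : ∀ s → ∃ λ c → c ↑ˡ p ≡ inner s
    spine s with splitAt q (inner s) in eq
    ... | inj₁ c = c , splitAt⁻¹-↑ˡ eq
    ... | inj₂ j = ⊥-elim (two-edges (hedge-inj P (trans (sym e₁) e₂)))
      where
      e₁ : j ≡ hedge P (inject₁ s)
      e₁ = leaf∈page⇒≡ (subst (_∈ₛ page _) (sym (splitAt⁻¹-↑ʳ eq)) (proj₂ (incident P (inject₁ s))))
      e₂ : j ≡ hedge P (suc s)
      e₂ = leaf∈page⇒≡ (subst (_∈ₛ page _) (sym (splitAt⁻¹-↑ʳ eq)) (proj₁ (incident P (suc s))))
      two-edges : ∀ {k} {s : Fin k} → inject₁ s ≢ suc s
      two-edges {s = suc s} eq = two-edges (Finₚ.suc-injective eq)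
    spine-inj : ∀ {s t} → proj₁ (spine s) ≡ proj₁ (spine t) → s ≡ t
    spine-inj {s} {t} eq =
      Finₚ.inject₁-injective (Finₚ.suc-injective (vert-inj P
        (trans (sym (proj₂ (spine s))) (trans (cong (_↑ˡ p) eq) (proj₂ (spine t))))))

-- The extremal number for large n.

theorem19 : (r : ℕ) → 3 ≤ r →
    Σ ℕ λ N → ∀ (n : ℕ) → N ≤ n → IsExConn r n (suc r) (suc (n ∸ r))
-- The square makes `cycle-short` applicable; the `level` term makes the empty set rich enough for q
-- extensions.
theorem19 (suc q) (s≤s 2≤q) = suc (suc (suc q) * suc (suc q) + level (suc q) q) , λ n N≤n →
  -- The book with q = r - 1 spine vertices and n - r + 1 pages has n vertices once r ≤ n.
  subst (λ n′ → Σ (Hypergraph (suc q) n′) λ H → Connected H × BergePathFree H (suc (suc q)) × size H ≡ suc (n ∸ suc q))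
    (trans (ℕₚ.+-suc q (n ∸ suc q)) (ℕₚ.m+[n∸m]≡n (r≤ N≤n)))
    (Book.book q _ , Book.book-connected q _ (inhabited 2≤q) zero , Book.book-free q _ , refl)
  , λ H conn free → UpperBound.edges≤ H free conn (ℕₚ.<⇒≤ 2≤q) N≤n
  where
  r≤ : ∀ {n} → suc (suc q) * suc (suc q) + level (suc q) q < n → suc q ≤ n
  r≤ N≤n = ≤-trans (ℕₚ.n≤1+n (suc q)) (≤-trans (ℕₚ.m≤m*n (suc (suc q)) (suc (suc q))) (≤-trans (ℕₚ.m≤m+n _ _) (ℕₚ.<⇒≤ N≤n)))
  inhabited : ∀ {k} → 2 ≤ k → Fin k
  inhabited (s≤s _) = zero
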